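{- Let $\mathcal T$ be a recursion safe $\textit{DL-Lite}^{\mathcal{HR}}$ TBox, $\mathcal C$ a set of order constraints that covers $\mathcal T$, and $q$ a conjunctive query. Let $\ell(\mathcal C)=\max\{|\mathbf A| \mid ord(s,\mathbf A,\prec)\in\mathcal C\}$ and let $q_{\mathcal C}$ be the $\ell(\mathcal C)$-rewriting of $q$ w.r.t. $\mathcal T$. Then, for each ABox $\mathcal A$ such that $(\mathcal T,\mathcal A)$ is consistent and $\mathcal C$-admissible, $cert(q,\mathcal T,\mathcal A)=cert(q_{\mathcal C},\emptyset,\mathcal A)$.
   Context: **Syntax and semantics.** Let $N_C,N_R,N_I$ be countably infinite sets of concept, role and individual names. A role is a role name $p$ or its inverse $p^-$; $N_R^{\pm}$ is the set of roles. Basic concepts are $\top$, $\bot$, $A\in N_C$, $\exists r$ ($r$ a role). TBoxes are in normal form: a $\textit{DL-Lite}_{\mathcal R}$ TBox is a finite set of axioms of the forms $A\sqsubseteq A'$, $A\sqsubseteq\exists p$, $\exists p\sqsubseteq A$, $p\sqsubseteq s$, $p\sqsubseteq s^-$, $\mathbf{disj}(A,A')$, $\mathbf{disj}(p,p')$ with $A,A'\in N_C$, $p,p',s\in N_R$. An ABox is a finite set of assertions $A(a)$, $p(a,b)$ with $a,b\in N_I$; $ind(\mathcal A)$ is the set of individuals in $\mathcal A$. A knowledge base (KB) is a pair $(\mathcal T,\mathcal A)$. Interpretations $\mathcal I=(\Delta^{\mathcal I},\cdot^{\mathcal I})$ have $A^{\mathcal I}\subseteq\Delta^{\mathcal I}$,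 $p^{\mathcal I}\subseteq\Delta^{\mathcal I}\times\Delta^{\mathcal I}$, $(p^-)^{\mathcal I}$ the converse of $p^{\mathcal I}$, $(\exists r)^{\mathcal I}=\{d\mid\exists d'.(d,d')\in r^{\mathcal I}\}$, $\top^{\mathcal I}=\Delta^{\mathcal I}$, $\bot^{\mathcal I}=\emptyset$, and $a^{\mathcal I}=a$ for individuals (standard names). $\mathcal I$ satisfies $\alpha\sqsubseteq\beta$ iff $\alpha^{\mathcal I}\subseteq\beta^{\mathcal I}$, and $\mathbf{disj}(\alpha,\beta)$ iff $\alpha^{\mathcal I}\cap\beta^{\mathcal I}=\emptyset$; assertions as usual. A model of a KB satisfies all its axioms and assertions; a KB is consistent if it has a model. **$\textit{DL-Lite}^{\mathcal{HR}}$.** Fix a set $N_{R_s}\subseteq N_R^{\pm}$ of simple roles closed under inverses; for each $r\in N_R\setminus N_{R_s}$, $r$ and $r^-$ are non-simple. A complex role inclusion (CRI) is $r\cdot s\sqsubseteq t$ with $r,s,t\in N_R$; $\mathcal I$ satisfies it if $(d_1,d_2)\in r^{\mathcal I}$ and $(d_2,d_3)\in s^{\mathcal I}$ imply $(d_1,d_3)\in t^{\mathcal I}$. A $\textit{DL-Lite}^{\mathcal{HR}}$ TBox is a $\textit{DL-Lite}_{\mathcal R}$ TBox that may also contain CRIs, such that for every CRI $r\cdot s\sqsubseteq t$ in it $s$ is simple and $t$ is non-simple, and whenever $s\sqsubseteq t\in\mathcal T$ with $t\in N_{R_s}$ then $s\in N_{R_s}$. **Recursion safety.** The recursion graph of $\mathcal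 T$ has a node $v_A$ (resp. $v_r$) for each concept name $A$ (resp. role name $r$) in $\mathcal T$, and edges: $v_{A_2}\to v_{A_1}$ for $A_1\sqsubseteq A_2\in\mathcal T$; $v_r\to v_t$ for $t\sqsubseteq r\in\mathcal T$; $v_p\to v_r$ for $r\sqsubseteq p^-\in\mathcal T$; $v_r\to v_A$ for $A\sqsubseteq\exists r\in\mathcal T$; $v_A\to v_r$ for $\exists r\sqsubseteq A\in\mathcal T$; $v_t\to v_r$ and $v_t\to v_s$ for $r\cdot s\sqsubseteq t\in\mathcal T$. Let $\sqsubseteq^{\mathsf s}_{\mathcal T}$ be the reflexive and transitive closure of the relation $\{(s_1,s_2)\mid s_1\sqsubseteq s_2\in\mathcal T,\ s_2\in N_{R_s}\}$. $\mathcal T$ is recursion safe if every CRI $r_1\cdot s\sqsubseteq r_2\in\mathcal T$ satisfies: (i) if $v_{r_2}$ participates in some cycle of the recursion graph, then the cycle has length at most one and $r_1=r_2$; (ii) there is no axiom $A\sqsubseteq\exists t\in\mathcal T$ with $t\sqsubseteq^{\mathsf s}_{\mathcal T}s$ or $t\sqsubseteq^{\mathsf s}_{\mathcal T}s^-$. **Queries.** A CQ is $q(\vec x)=\exists\vec y.\varphi(\vec x,\vec y)$ with $\varphi$ a conjunction of atoms $A(x)$, $r(x,y)$ ($A\in N_C$, $r\in N_R$) and $t=t'$ ($t,t'$ variables or individuals); it is identified with its set of atoms; $\vec x$ are the answer variables, $vars(q)$ all variables. $cert(q,\mathcal T,\mathcal A)$ is the set of tuples $\vec a$ over $ind(\mathcal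 A)$ with $\mathcal I\models q(\vec a)$ for all models $\mathcal I$ of $(\mathcal T,\mathcal A)$. For a set $Q$ of CQs (read as their union), $cert(Q,\emptyset,\mathcal A)=\bigcup_{q'\in Q}cert(q',\emptyset,\mathcal A)$. **Rewriting.** For a CQ $q$, $z^q$ is a fixed variable not occurring in $q$. Write $q\leadsto_{\mathcal T}q'$ if $q'$ results from $q$ by one of the following (replacing the indicated atom(s)): (S1) $A_1\sqsubseteq A_2\in\mathcal T$: replace $A_2(x)$ by $A_1(x)$; (S2) $A\sqsubseteq\exists r\in\mathcal T$ and $y$ a non-answer variable occurring only once in $q$: replace $r(x,y)$ by $A(x)$; (S3) $\exists r\sqsubseteq A\in\mathcal T$: replace $A(x)$ by $r(x,z^q)$; (S4) $r\sqsubseteq s\in\mathcal T$: replace $s(x,y)$ by $r(x,y)$; (S5) $r\sqsubseteq s^-\in\mathcal T$: replace $s(x,y)$ by $r(y,x)$; (S6) $t\cdot s\sqsubseteq r\in\mathcal T$: replace $r(x,y)$ by $t(x,z^q),s(z^q,y)$; (S7) for $x,y\in vars(q)$, apply the variable substitution $[x\mapsto y]$ to $q$. $\leadsto^*_{\mathcal T}$ denotes finite sequences of steps, and $rew(q,\mathcal T)=\{q\}\cup\{q'\mid q\leadsto^*_{\mathcal T}q'\}$. **$k$-unfolding and $k$-rewriting.** For recursion safe $\mathcal T$ and $k\ge 0$, the $k$-unfolding $\mathcal T_k$ is obtained from $\mathcal T$ by replacing each $r\cdot s\sqsubseteq r\in\mathcal T$ with the axioms $r\sqsubseteq r_0$,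 $r_{j-1}\cdot s\sqsubseteq r_j$ ($1\le j\le k$) and $r_j\sqsubseteq\hat r$ ($0\le j\le k$), where $\hat r$ and each $r_j$ are fresh role names. For a CQ $q$ over the signature of $\mathcal T$, $\hat q$ is obtained by replacing each atom $r(x,y)$ of $q$, where $r$ is a recursive role (i.e., $r\cdot s\sqsubseteq r\in\mathcal T$ for some $s$), by $\hat r(x,y)$. The $k$-rewriting of $q$ w.r.t. $\mathcal T$ is $rew(\hat q,\mathcal T_k)$. **The interpretation $\mathcal E_{\mathcal T,\mathcal A}$.** Its domain is $D_0\cup D_1\cup D_2$ with $D_0=ind(\mathcal A)$, $D_1=\{c_{ar}\mid a\in D_0,\ r\text{ occurs on the right-hand side of a concept inclusion in }\mathcal T\}$, $D_2=\{c_r\mid r\text{ occurs on the right-hand side of a concept inclusion in }\mathcal T\}$ (fresh individuals), each element is interpreted as itself, and concept and role names are interpreted by the minimal sets such that ($B$ basic concept, $A\in N_C$): (1) assertions of $\mathcal A$ hold; (2) if $B\sqsubseteq\exists r\in\mathcal T$ and $a\in D_0$ is in $B$, then $(a,c_{ar})\in r$; (3) if $B\sqsubseteq\exists r\in\mathcal T$ and $d\in D_1\cup D_2$ is in $B$, then $(d,c_r)\in r$; (4) if $B\sqsubseteq A\in\mathcal T$ and $d\in B$ then $d\in A$; (5) if $r_1\sqsubseteq r_2\in\mathcal T$ and $(a,b)\in r_1$ then $(a,b)\in r_2$; (6) if $r_1\sqsubseteq r_2^-\in\mathcal T$ and $(a,b)\in r_1$ then $(b,a)\in r_2$; (7) if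 $r\cdot s\sqsubseteq t\in\mathcal T$, $(a,b)\in r$, $(b,c)\in s$ then $(a,c)\in t$. **Order constraints.** An order constraint is $ord(s,\mathbf A,\prec)$ with $s\in N_{R_s}$, $\mathbf A\subseteq N_C$ finite and $\prec$ a strict partial order over $\mathbf A$. $\mathcal I$ satisfies it if $s^{\mathcal I}\subseteq\bigcup_{A_1,A_2\in\mathbf A}(A_1^{\mathcal I}\times A_2^{\mathcal I})$ and $s^{\mathcal I}\cap\bigcup_{A_1,A_2\in\mathbf A,\,A_1\not\prec A_2}(A_1^{\mathcal I}\times A_2^{\mathcal I})=\emptyset$. For a role $r$ let $S_r=\{s\mid r\cdot s\sqsubseteq r\in\mathcal T\}$. A set $\mathcal C$ of order constraints covers $\mathcal T$ if for each $S_r$ there is a strict partial order $(\prec,\mathbf A)$ such that for each $s\in S_r$ there is $ord(s,\mathbf A',\prec)\in\mathcal C$ with $\mathbf A'\subseteq\mathbf A$. $(\mathcal T,\mathcal A)$ is $\mathcal C$-admissible if $\mathcal E_{\mathcal T,\mathcal A}$ satisfies every constraint in $\mathcal C$.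
   Formalization: In the k-unfolding, axioms r⊑t, r⊑t⁻ and CRIs r·s⊑t (t≠r) with r recursive get r̂ in place of r on the left, and S7 also drops equality atoms t=t; as printed the claim fails, e.g. for T={r·s⊑r, r⊑t}, q=t(x,y). -}

module Defs where

open import Level using (0ℓ; suc)
open import Data.Nat.Base as ℕ using (ℕ; zero; _≤_)
import Data.Nat.Properties as ℕ
open import Data.List.Base using (List; []; _∷_; _++_; [_]; map; concatMap; filter; length; upTo)
open import Data.List.Membership.Propositional using (_∈_; _∉_; find; lose)
open import Data.List.Relation.Unary.Any using (Any; any?)
open import Data.List.Relation.Unary.Linked using (Linked)
open import Data.List.Relation.Unary.Unique.Propositional using (Unique)
open import Data.Vec.Base as Vec using (Vec; toList)
open import Data.Vec.Relation.Unary.All as VecAll using ()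
open import Data.Product.Base using (∃; ∃₂; _×_; _,_)
open import Data.Sum.Base using (_⊎_)
open import Data.Empty using (⊥)
open import Function.Bundles using (_↔_)
open import Function.Definitions using (Injective)
open import Relation.Nullary using (¬_; Dec; yes; no; ¬?; map′; _×-dec_)
open import Relation.Unary using (Pred; Empty)
open import Relation.Binary.Core using (Rel; _⇔_)
open import Relation.Binary.Definitions using (DecidableEquality)
open import Relation.Binary.Structures using (IsStrictPartialOrder)
open import Relation.Binary.PropositionalEquality.Core using (_≡_; _≢_; refl; cong)
open import Relation.Binary.Construct.Closure.ReflexiveTransitive using (Star)

------------------------------------------------------------------------
-- Vocabularies

record Vocabulary : Set₁ where
  field
    NC NR NI NV : Set   -- concept, role and individual names; query variables
    _≟ᶜ_ : DecidableEquality NC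
    _≟ʳ_ : DecidableEquality NR
    _≟ⁱ_ : DecidableEquality NI
    _≟ᵛ_ : DecidableEquality NV

CountablyInfinite : Vocabulary → Set
CountablyInfinite V = (NC ↔ ℕ) × (NR ↔ ℕ) × (NI ↔ ℕ) × (NV ↔ ℕ)
  where open Vocabulary V

------------------------------------------------------------------------
-- Syntax

module _ (V : Vocabulary) where
  open Vocabulary V

  data Role : Set where
    name inverse : NR → Role

  infix 4 _⊑ᶜ_ _⊑∃_ ∃_⊑_ _⊑ʳ_ _⊑ʳ_⁻ _·_⊑_

  data Axiom : Set where
    _⊑ᶜ_   : NC → NC → Axiom
    _⊑∃_   : NC → NR → Axiom
    ∃_⊑_   : NR → NC → Axiom
    _⊑ʳ_   : NR → NR → Axiom
    _⊑ʳ_⁻  : NR → NR → Axiom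
    disjᶜ  : NC → NC → Axiom
    disjʳ  : NR → NR → Axiom
    _·_⊑_  : NR → NR → NR → Axiom

  TBox : Set
  TBox = List Axiom

  data Assertion : Set where
    conceptA : NC → NI → Assertion
    roleA    : NR → NI → NI → Assertion

  ABox : Set
  ABox = List Assertion

  data Term : Set where
    var : NV → Term
    ind : NI → Term

  data Atom : Set where
    concept : NC → NV → Atom
    role    : NR → NV → NV → Atom
    equal   : Term → Term → Atom

  -- Answer variables may repeat, because rewriting can identify them.
  record CQ (n : ℕ) : Set where
    constructor query
    field
      head : Vec NV n
      body : List Atom

module _ {V : Vocabulary} where
  open Vocabulary V

  flip : Role V → Role V
  flip (name p)    = inverse p
  flip (inverse p) = name p

  individuals : ABox V → List NI
  individuals = concatMap λ where
    (conceptA _ a) → a ∷ []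
    (roleA _ a b)  → a ∷ b ∷ []

  termVars : Term V → List NV
  termVars (var x) = x ∷ []
  termVars (ind _) = []

  atomVars : Atom V → List NV
  atomVars (concept _ x) = x ∷ []
  atomVars (role _ x y)  = x ∷ y ∷ []
  atomVars (equal t u)   = termVars t ++ termVars u

  vars : ∀ {n} → CQ V n → List NV
  vars q = toList (CQ.head q) ++ concatMap atomVars (CQ.body q)

  _≟ᵗ_ : DecidableEquality (Term V)
  var x ≟ᵗ var y = map′ (cong var) (λ { refl → refl }) (x ≟ᵛ y)
  var _ ≟ᵗ ind _ = no λ ()
  ind _ ≟ᵗ var _ = no λ ()
  ind a ≟ᵗ ind b = map′ (cong ind) (λ { refl → refl }) (a ≟ⁱ b)

  _≟ᵃ_ : DecidableEquality (Atom V)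
  concept A x ≟ᵃ concept B y =
    map′ (λ { (refl , refl) → refl }) (λ { refl → refl , refl }) (A ≟ᶜ B ×-dec x ≟ᵛ y)
  concept _ _ ≟ᵃ role _ _ _  = no λ ()
  concept _ _ ≟ᵃ equal _ _   = no λ ()
  role _ _ _  ≟ᵃ concept _ _ = no λ ()
  role r x y  ≟ᵃ role s u v  =
    map′ (λ { (refl , refl , refl) → refl }) (λ { refl → refl , refl , refl })
         (r ≟ʳ s ×-dec x ≟ᵛ u ×-dec y ≟ᵛ v)
  role _ _ _  ≟ᵃ equal _ _   = no λ ()
  equal _ _   ≟ᵃ concept _ _ = no λ ()
  equal _ _   ≟ᵃ role _ _ _  = no λ ()
  equal t u   ≟ᵃ equal v w   =
    map′ (λ { (refl , refl) → refl }) (λ { refl → refl , refl }) (t ≟ᵗ v ×-dec u ≟ᵗ w)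

------------------------------------------------------------------------
-- Semantics

module _ (V : Vocabulary) where
  open Vocabulary V

  record Structure : Set₁ where
    field
      Δ     : Set
      concᴵ : NC → Δ → Set
      roleᴵ : NR → Δ → Δ → Set

  -- Standard names: the individuals form a subset of the domain, given here
  -- by an injection.
  record Interpretation : Set₁ where
    field
      structure : Structure
    open Structure structure public
    field
      indᴵ      : NI → Δ
      injective : Injective _≡_ _≡_ indᴵ

module _ {V : Vocabulary} where
  open Vocabulary V

  ⟦_⟧ʳ : Role V → (S : Structure V) → Rel (Structure.Δ S) 0ℓ
  ⟦ name p ⟧ʳ    S d e = Structure.roleᴵ S p d e
  ⟦ inverse p ⟧ʳ S d e = Structure.roleᴵ S p e d

  _⊨ᵃˣ_ : Interpretation V → Axiom V → Set
  I ⊨ᵃˣ α = sat α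
    where
    open Interpretation I
    sat : Axiom V → Set
    sat (A ⊑ᶜ B)    = ∀ {d} → concᴵ A d → concᴵ B d
    sat (A ⊑∃ p)    = ∀ {d} → concᴵ A d → ∃ λ e → roleᴵ p d e
    sat (∃ p ⊑ A)   = ∀ {d} → (∃ λ e → roleᴵ p d e) → concᴵ A d
    sat (p ⊑ʳ s)    = ∀ {d e} → roleᴵ p d e → roleᴵ s d e
    sat (p ⊑ʳ s ⁻)  = ∀ {d e} → roleᴵ p d e → roleᴵ s e d
    sat (disjᶜ A B) = ∀ {d} → ¬ (concᴵ A d × concᴵ B d)
    sat (disjʳ p s) = ∀ {d e} → ¬ (roleᴵ p d e × roleᴵ s d e)
    sat (r · s ⊑ t) = ∀ {d e f} → roleᴵ r d e → roleᴵ s e f → roleᴵ t d f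

  _⊨ᵃˢ_ : Interpretation V → Assertion V → Set
  I ⊨ᵃˢ conceptA A a = concᴵ A (indᴵ a)           where open Interpretation I
  I ⊨ᵃˢ roleA p a b  = roleᴵ p (indᴵ a) (indᴵ b)  where open Interpretation I

  record IsModel (I : Interpretation V) (T : TBox V) (𝒜 : ABox V) : Set where
    field
      axioms     : ∀ {α} → α ∈ T → I ⊨ᵃˣ α
      assertions : ∀ {β} → β ∈ 𝒜 → I ⊨ᵃˢ β

  Consistent : TBox V → ABox V → Set₁
  Consistent T 𝒜 = ∃ λ I → IsModel I T 𝒜

  module _ (I : Interpretation V) (π : NV → Interpretation.Δ I) where
    open Interpretation I

    ⟦_⟧ᵗ : Term V → Δ
    ⟦ var x ⟧ᵗ = π x
    ⟦ ind a ⟧ᵗ = indᴵ a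

    SatisfiesAtom : Atom V → Set
    SatisfiesAtom (concept A x) = concᴵ A (π x)
    SatisfiesAtom (role r x y)  = roleᴵ r (π x) (π y)
    SatisfiesAtom (equal t u)   = ⟦ t ⟧ᵗ ≡ ⟦ u ⟧ᵗ

  _⊨_⟨_⟩ : ∀ {n} → Interpretation V → CQ V n → Vec NI n → Set
  I ⊨ q ⟨ as ⟩ = ∃ λ π →
      Vec.map π (CQ.head q) ≡ Vec.map (Interpretation.indᴵ I) as
    × (∀ {α} → α ∈ CQ.body q → SatisfiesAtom I π α)

  cert : ∀ {n} → CQ V n → TBox V → ABox V → Pred (Vec NI n) (suc 0ℓ)
  cert q T 𝒜 as =
    VecAll.All (_∈ individuals 𝒜) as × (∀ I → IsModel I T 𝒜 → I ⊨ q ⟨ as ⟩)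

  certᵁ : ∀ {n} → Pred (CQ V n) 0ℓ → TBox V → ABox V → Pred (Vec NI n) (suc 0ℓ)
  certᵁ Q T 𝒜 as = ∃ λ q → Q q × cert q T 𝒜 as

------------------------------------------------------------------------
-- Simple roles and recursion safety

record SimpleRoles (V : Vocabulary) : Set₁ where
  field
    Simple : Pred (Role V) 0ℓ
    closed : ∀ {r} → Simple r → Simple (flip r)

module _ {V : Vocabulary} where
  open Vocabulary V

  record IsDL-Lite-HR (N : SimpleRoles V) (T : TBox V) : Set where
    open SimpleRoles N
    field
      cri         : ∀ {r s t} → (r · s ⊑ t) ∈ T → Simple (name s) × ¬ Simple (name t)
      inclusion   : ∀ {s t} → (s ⊑ʳ t) ∈ T → Simple (name t) → Simple (name s)
      inclusion⁻  : ∀ {s t} → (s ⊑ʳ t ⁻) ∈ T → Simple (inverse t) → Simple (name s)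

  data Node : Set where
    vᶜ : NC → Node
    vʳ : NR → Node

  data Edge (T : TBox V) : Rel Node 0ℓ where
    conceptInclusion : ∀ {A B} → (A ⊑ᶜ B) ∈ T → Edge T (vᶜ B) (vᶜ A)
    roleInclusion    : ∀ {r t} → (t ⊑ʳ r) ∈ T → Edge T (vʳ r) (vʳ t)
    inverseInclusion : ∀ {p r} → (r ⊑ʳ p ⁻) ∈ T → Edge T (vʳ p) (vʳ r)
    existsRight      : ∀ {A r} → (A ⊑∃ r) ∈ T → Edge T (vʳ r) (vᶜ A)
    existsLeft       : ∀ {A r} → (∃ r ⊑ A) ∈ T → Edge T (vᶜ A) (vʳ r)
    criFirst         : ∀ {r s t} → (r · s ⊑ t) ∈ T → Edge T (vʳ t) (vʳ r)
    criSecond        : ∀ {r s t} → (r · s ⊑ t) ∈ T → Edge T (vʳ t) (vʳ s)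

  -- Cycles visit distinct nodes; otherwise going twice round a loop would be
  -- a cycle of length two.
  IsCycle : TBox V → List Node → Set
  IsCycle T []       = ⊥
  IsCycle T (v ∷ vs) = Unique (v ∷ vs) × Linked (Edge T) (v ∷ vs ++ [ v ])

  module _ (N : SimpleRoles V) (T : TBox V) where
    open SimpleRoles N

    data SimpleInclusion : Rel (Role V) 0ℓ where
      direct  : ∀ {p s} → (p ⊑ʳ s) ∈ T → Simple (name s) → SimpleInclusion (name p) (name s)
      inverse : ∀ {p s} → (p ⊑ʳ s ⁻) ∈ T → Simple (inverse s) → SimpleInclusion (name p) (inverse s)

    _⊑ˢ_ : Rel (Role V) 0ℓ
    _⊑ˢ_ = Star SimpleInclusion

    RecursionSafe : Set
    RecursionSafe = ∀ {r₁ s r₂} → (r₁ · s ⊑ r₂) ∈ T →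
        (∀ c → IsCycle T c → vʳ r₂ ∈ c → length c ≤ 1 × r₁ ≡ r₂)
      × (∀ {A t} → (A ⊑∃ t) ∈ T → ¬ (name t ⊑ˢ name s) × ¬ (name t ⊑ˢ inverse s))

------------------------------------------------------------------------
-- Rewriting

record FreshVariable (V : Vocabulary) : Set where
  open Vocabulary V
  field
    z     : ∀ {n} → CQ V n → NV
    fresh : ∀ {n} (q : CQ V n) → z q ∉ vars q

module _ {V : Vocabulary} where
  open Vocabulary V

  -- The body is read as a set of atoms, so every copy of α goes.
  _[_≔_] : ∀ {n} → CQ V n → Atom V → List (Atom V) → CQ V n
  query xs φ [ α ≔ βs ] = query xs (filter (λ γ → ¬? (γ ≟ᵃ α)) φ ++ βs)

  module _ (x y : NV) where

    substᵛ : NV → NV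
    substᵛ u with u ≟ᵛ x
    ... | yes _ = y
    ... | no  _ = u

    substᵗ : Term V → Term V
    substᵗ (var u) = var (substᵛ u)
    substᵗ (ind a) = ind a

    substᵃ : Atom V → Atom V
    substᵃ (concept A u) = concept A (substᵛ u)
    substᵃ (role r u v)  = role r (substᵛ u) (substᵛ v)
    substᵃ (equal t u)   = equal (substᵗ t) (substᵗ u)

  Trivial : Atom V → Set
  Trivial (equal t u)   = t ≡ u
  Trivial (concept _ _) = ⊥
  Trivial (role _ _ _)  = ⊥

  trivial? : ∀ α → Dec (Trivial α)
  trivial? (equal t u)   = t ≟ᵗ u
  trivial? (concept _ _) = no λ ()
  trivial? (role _ _ _)  = no λ ()

  -- The substitution also acts on the answer tuple.  Equalities t = t are
  -- dropped: left in place, they would count as further occurrences of a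
  -- variable in rule s2 and lose answers.
  _[_↦_] : ∀ {n} → CQ V n → NV → NV → CQ V n
  query xs φ [ x ↦ y ] =
    query (Vec.map (substᵛ x y) xs) (filter (λ α → ¬? (trivial? α)) (map (substᵃ x y) φ))

  -- y occurs exactly once in the set of atoms of q, namely in role r x y.
  OccursOnlyIn : ∀ {n} → NR → NV → NV → CQ V n → Set
  OccursOnlyIn r x y q =
    x ≢ y × (∀ {α} → α ∈ CQ.body q → y ∈ atomVars α → α ≡ role r x y)

  module _ (Z : FreshVariable V) (T : TBox V) where
    open FreshVariable Z

    data Step {n} (q : CQ V n) : CQ V n → Set where
      s1 : ∀ {A B x} → (A ⊑ᶜ B) ∈ T → concept B x ∈ CQ.body q →
           Step q (q [ concept B x ≔ concept A x ∷ [] ])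
      s2 : ∀ {A r x y} → (A ⊑∃ r) ∈ T → role r x y ∈ CQ.body q →
           y ∉ toList (CQ.head q) → OccursOnlyIn r x y q →
           Step q (q [ role r x y ≔ concept A x ∷ [] ])
      s3 : ∀ {A r x} → (∃ r ⊑ A) ∈ T → concept A x ∈ CQ.body q →
           Step q (q [ concept A x ≔ role r x (z q) ∷ [] ])
      s4 : ∀ {r s x y} → (r ⊑ʳ s) ∈ T → role s x y ∈ CQ.body q →
           Step q (q [ role s x y ≔ role r x y ∷ [] ])
      s5 : ∀ {r s x y} → (r ⊑ʳ s ⁻) ∈ T → role s x y ∈ CQ.body q →
           Step q (q [ role s x y ≔ role r y x ∷ [] ])
      s6 : ∀ {t s r x y} → (t · s ⊑ r) ∈ T → role r x y ∈ CQ.body q →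
           Step q (q [ role r x y ≔ role t x (z q) ∷ role s (z q) y ∷ [] ])
      s7 : ∀ {x y} → x ∈ vars q → y ∈ vars q → Step q (q [ x ↦ y ])

    rew : ∀ {n} → CQ V n → Pred (CQ V n) 0ℓ
    rew = Star Step

------------------------------------------------------------------------
-- k-unfolding and k-rewriting

data UnfoldedRole (R : Set) : Set where
  base  : R → UnfoldedRole R
  level : R → ℕ → UnfoldedRole R
  hat   : R → UnfoldedRole R

decUnfolded : ∀ {R} → DecidableEquality R → DecidableEquality (UnfoldedRole R)
decUnfolded _≟_ (base r)    (base s)    = map′ (cong base) (λ { refl → refl }) (r ≟ s)
decUnfolded _≟_ (base _)    (level _ _) = no λ ()
decUnfolded _≟_ (base _)    (hat _)     = no λ ()
decUnfolded _≟_ (level _ _) (base _)    = no λ ()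
decUnfolded _≟_ (level r i) (level s j) =
  map′ (λ { (refl , refl) → refl }) (λ { refl → refl , refl }) (r ≟ s ×-dec i ℕ.≟ j)
decUnfolded _≟_ (level _ _) (hat _)     = no λ ()
decUnfolded _≟_ (hat _)     (base _)    = no λ ()
decUnfolded _≟_ (hat _)     (level _ _) = no λ ()
decUnfolded _≟_ (hat r)     (hat s)     = map′ (cong hat) (λ { refl → refl }) (r ≟ s)

-- The vocabulary with the new role names adjoined, so that these are fresh
-- for every TBox, query and ABox over V.
unfolded : Vocabulary → Vocabulary
unfolded V = record
  { NC = NC ; NR = UnfoldedRole NR ; NI = NI ; NV = NV
  ; _≟ᶜ_ = _≟ᶜ_ ; _≟ʳ_ = decUnfolded _≟ʳ_ ; _≟ⁱ_ = _≟ⁱ_ ; _≟ᵛ_ = _≟ᵛ_ }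
  where open Vocabulary V

module _ {V : Vocabulary} where
  open Vocabulary V

  liftABox : ABox V → ABox (unfolded V)
  liftABox = map λ where
    (conceptA A a) → conceptA A a
    (roleA p a b)  → roleA (base p) a b

  module _ (T : TBox V) where

    S : NR → Pred NR 0ℓ
    S r s = (r · s ⊑ r) ∈ T

    Recursive : Pred NR 0ℓ
    Recursive r = ∃ λ s → S r s

    recursive? : ∀ r → Dec (Recursive r)
    recursive? r = map′ to from (any? loop? T)
      where
      Loop : Axiom V → Set
      Loop α = ∃ λ s → α ≡ (r · s ⊑ r)
      loop? : ∀ α → Dec (Loop α)
      loop? (r₁ · s ⊑ t) = map′ (λ { (refl , refl) → s , refl }) (λ { (_ , refl) → refl , refl })
                                (r₁ ≟ʳ r ×-dec t ≟ʳ r)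
      loop? (_ ⊑ᶜ _)     = no λ ()
      loop? (_ ⊑∃ _)     = no λ ()
      loop? (∃ _ ⊑ _)    = no λ ()
      loop? (_ ⊑ʳ _)     = no λ ()
      loop? (_ ⊑ʳ _ ⁻)   = no λ ()
      loop? (disjᶜ _ _)  = no λ ()
      loop? (disjʳ _ _)  = no λ ()
      to : Any Loop T → Recursive r
      to p with find p
      ... | _ , α∈T , s , refl = s , α∈T
      from : Recursive r → Any Loop T
      from (s , α∈T) = lose α∈T (s , refl)

    hatRole : NR → UnfoldedRole NR
    hatRole r with recursive? r
    ... | yes _ = hat r
    ... | no  _ = base r

    hatQuery : ∀ {n} → CQ V n → CQ (unfolded V) n
    hatQuery (query xs φ) = query xs (map hatAtom φ)
      where
      hatTerm : Term V → Term (unfolded V)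
      hatTerm (var x) = var x
      hatTerm (ind a) = ind a
      hatAtom : Atom V → Atom (unfolded V)
      hatAtom (concept A x) = concept A x
      hatAtom (role r x y)  = role (hatRole r) x y
      hatAtom (equal t u)   = equal (hatTerm t) (hatTerm u)

    unfoldLoop : ℕ → NR → NR → List (Axiom (unfolded V))
    unfoldLoop k r s =
         [ base r ⊑ʳ level r 0 ]
      ++ map (λ j → level r j · base s ⊑ level r (ℕ.suc j)) (upTo k)
      ++ map (λ j → level r j ⊑ʳ hat r) (upTo (ℕ.suc k))

    -- Once r · s ⊑ r is removed, base r no longer contains the pairs it
    -- produces; these are in hat r.  A role inclusion or a remaining composition
    -- that starts from a recursive r must therefore start from hat r, exactly as
    -- the atoms of a query do.  With base r there, T = {r · s ⊑ r, r ⊑ t} would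
    -- lose answers to t(x,y).  For ∃ r ⊑ A the two agree, since r · s ⊑ r
    -- preserves first components.
    unfoldAxiom : ℕ → Axiom V → List (Axiom (unfolded V))
    unfoldAxiom k (A ⊑ᶜ B)    = [ A ⊑ᶜ B ]
    unfoldAxiom k (A ⊑∃ p)    = [ A ⊑∃ base p ]
    unfoldAxiom k (∃ p ⊑ A)   = [ ∃ base p ⊑ A ]
    unfoldAxiom k (p ⊑ʳ s)    = [ hatRole p ⊑ʳ base s ]
    unfoldAxiom k (p ⊑ʳ s ⁻)  = [ hatRole p ⊑ʳ base s ⁻ ]
    unfoldAxiom k (disjᶜ A B) = [ disjᶜ A B ]
    unfoldAxiom k (disjʳ p s) = [ disjʳ (base p) (base s) ]
    unfoldAxiom k (r · s ⊑ t) with r ≟ʳ t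
    ... | yes _ = unfoldLoop k r s
    ... | no  _ = [ hatRole r · base s ⊑ base t ]

    k-unfolding : ℕ → TBox (unfolded V)
    k-unfolding k = concatMap (unfoldAxiom k) T

  k-rewriting : FreshVariable (unfolded V) → ℕ → TBox V → ∀ {n} → CQ V n → Pred (CQ (unfolded V) n) 0ℓ
  k-rewriting Z k T q = rew Z (k-unfolding T k) (hatQuery T q)

------------------------------------------------------------------------
-- The structure ℰ

module _ {V : Vocabulary} (T : TBox V) (𝒜 : ABox V) where
  open Vocabulary V

  -- The membership proofs are irrelevant, so that each individual or role
  -- contributes a single element.
  data Element : Set where
    named : (a : NI) → .(a ∈ individuals 𝒜) → Element
    c₁    : (a : NI) (r : NR) → .(a ∈ individuals 𝒜) → .(∃ λ A → (A ⊑∃ r) ∈ T) → Element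
    c₂    : (r : NR) → .(∃ λ A → (A ⊑∃ r) ∈ T) → Element

  data Anonymous : Element → Set where
    c₁ : ∀ {a r} .{a∈} .{r∈} → Anonymous (c₁ a r a∈ r∈)
    c₂ : ∀ {r} .{r∈} → Anonymous (c₂ r r∈)

  mutual
    data ℰᶜ : NC → Element → Set where
      assertion : ∀ {A a} .{a∈} → conceptA A a ∈ 𝒜 → ℰᶜ A (named a a∈)
      inclusion : ∀ {A B d} → (A ⊑ᶜ B) ∈ T → ℰᶜ A d → ℰᶜ B d
      exists    : ∀ {r A d e} → (∃ r ⊑ A) ∈ T → ℰʳ r d e → ℰᶜ A d

    data ℰʳ : NR → Element → Element → Set where
      assertion   : ∀ {p a b} .{a∈} .{b∈} → roleA p a b ∈ 𝒜 → ℰʳ p (named a a∈) (named b b∈)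
      witness₁    : ∀ {A r a} .{a∈} .{r∈} → (A ⊑∃ r) ∈ T →
                    ℰᶜ A (named a a∈) → ℰʳ r (named a a∈) (c₁ a r a∈ r∈)
      witness₂    : ∀ {A r d} .{r∈} → (A ⊑∃ r) ∈ T → Anonymous d →
                    ℰᶜ A d → ℰʳ r d (c₂ r r∈)
      inclusion   : ∀ {r s d e} → (r ⊑ʳ s) ∈ T → ℰʳ r d e → ℰʳ s d e
      inclusion⁻  : ∀ {r s d e} → (r ⊑ʳ s ⁻) ∈ T → ℰʳ r d e → ℰʳ s e d
      composition : ∀ {r s t d e f} → (r · s ⊑ t) ∈ T → ℰʳ r d e → ℰʳ s e f → ℰʳ t d f

  ℰ : Structure V
  ℰ = record { Δ = Element ; concᴵ = ℰᶜ ; roleᴵ = ℰʳ }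

------------------------------------------------------------------------
-- Order constraints

-- _≺_ is a relation on carrier, not a restriction to it of a larger one.  So
-- constraints that share _≺_ have all ≺-comparable names in common, which is
-- what bounds paths along several roles of the same S T r.
record StrictOrder (V : Vocabulary) : Set₁ where
  open Vocabulary V
  infix 4 _≺_
  field
    carrier              : List NC
    unique               : Unique carrier
    _≺_                  : Rel NC 0ℓ
    over                 : ∀ {A B} → A ≺ B → A ∈ carrier × B ∈ carrier
    isStrictPartialOrder : IsStrictPartialOrder _≡_ _≺_

record OrderConstraint {V : Vocabulary} (N : SimpleRoles V) : Set₁ where
  field
    roleName : Role V
    simple   : SimpleRoles.Simple N roleName
    order    : StrictOrder V
  open StrictOrder order public

module _ {V : Vocabulary} {N : SimpleRoles V} where
  open Vocabulary V

  record Satisfies (M : Structure V) (c : OrderConstraint N) : Set where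
    open Structure M
    open OrderConstraint c
    field
      typed   : ∀ {d e} → ⟦ roleName ⟧ʳ M d e →
                ∃₂ λ A B → A ∈ carrier × B ∈ carrier × concᴵ A d × concᴵ B e
      ordered : ∀ {A B} → A ∈ carrier → B ∈ carrier → ¬ (A ≺ B) →
                ∀ {d e} → ¬ (⟦ roleName ⟧ʳ M d e × concᴵ A d × concᴵ B e)

  Covers : Pred (OrderConstraint N) 0ℓ → TBox V → Set₁
  Covers 𝒞 T = ∀ r → ∃ λ (o : StrictOrder V) → ∀ {s} → S T r s →
    ∃ λ (c : OrderConstraint N) → 𝒞 c
      × OrderConstraint.roleName c ≡ name s
      × (∀ {A} → A ∈ OrderConstraint.carrier c → A ∈ StrictOrder.carrier o)
      × OrderConstraint._≺_ c ⇔ StrictOrder._≺_ o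

  Admissible : Pred (OrderConstraint N) 0ℓ → TBox V → ABox V → Set₁
  Admissible 𝒞 T 𝒜 = ∀ {c} → 𝒞 c → Satisfies (ℰ T 𝒜) c

  -- ℓ is the maximum of the sizes |𝐀|, taken to be 0 if there are no constraints.
  IsMaxSize : Pred (OrderConstraint N) 0ℓ → ℕ → Set₁
  IsMaxSize 𝒞 ℓ = (∀ {c} → 𝒞 c → size c ≤ ℓ)
    × ((∃ λ c → 𝒞 c × size c ≡ ℓ) ⊎ (Empty 𝒞 × ℓ ≡ 0))
    where
    size : OrderConstraint N → ℕ
    size c = length (OrderConstraint.carrier c)

{-# OPTIONS --safe #-}

-- For ⊇, a model of (T , 𝒜) that reads base r, level r j and hat r all as r
-- satisfies the ℓ-unfolding, and rewriting steps can be undone in it.  For ⊆, use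
-- the chase of (T , 𝒜), with a successor  child d r  for every d that needs one.
--
-- Rewriting is complete for the chase of any TBox, by induction on the total
-- size of the derivations of the atoms of q: the last rule of a derivation is
-- undone by s1 or s3-s6.  If only assertions and successor edges remain, s7
-- makes the match injective; a deepest anonymous variable then occurs in a
-- single atom, which s2 removes.
--
-- In the chase, r(d,e) for a recursive r is an edge of base r followed by a path
-- of edges from S T r.  Its image in ℰ carries, up to double negation, a
-- ≺-descending list with one concept name per vertex, so that the path has at
-- most ℓ edges and is derived by the levels of the ℓ-unfolding.

module Submission where

open import Defs
open import Level using (0ℓ)
open import Data.Nat.Base as ℕ using (ℕ; suc; _+_; _≤_; _<_; z≤n; s≤s)
import Data.Nat.Properties as ℕ
open import Data.Nat.Induction using (<-wellFounded)
open import Data.List.Base using (List; []; _∷_; _++_; map; filter; length; upTo)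
open import Data.List.Properties using (filter-accept; filter-reject; filter-notAll)
open import Data.List.Membership.Propositional using (_∈_; _∉_; find; lose)
open import Data.List.Membership.Propositional.Properties
  using (∈-++⁺ˡ; ∈-++⁺ʳ; ∈-++⁻; ∈-map⁺; ∈-map⁻; ∈-filter⁺; ∈-filter⁻; ∈-concatMap⁺; ∈-concatMap⁻; ∈-upTo⁺)
open import Data.List.Relation.Unary.Any using (here; there; any?)
import Data.List.Relation.Unary.All as All
import Data.List.Relation.Unary.AllPairs as AllPairs
open import Data.List.Relation.Unary.Linked as Linked using (Linked; [-]; _∷_)
open import Data.List.Relation.Unary.Linked.Properties using (Linked⇒AllPairs)
open import Data.List.Relation.Unary.Unique.Propositional using (Unique; []; _∷_)
open import Data.Vec.Base as Vec using (Vec; []; _∷_; toList)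
open import Data.Vec.Properties using (∷-injective; map-∘; toList-map)
import Data.Vec.Relation.Unary.All as VecAll
open import Data.Product.Base using (∃; ∃₂; _×_; _,_; proj₁; proj₂)
open import Data.Sum.Base using (_⊎_; inj₁; inj₂; [_,_]′)
open import Data.Empty using (⊥-elim)
open import Function.Base using (_∘_; id; const; case_of_) renaming (flip to swapArgs)
open import Induction.WellFounded using (Acc; acc)
open import Relation.Nullary using (¬_; yes; no; ¬?; map′; _×-dec_; contradiction; decidable-stable)
open import Relation.Unary using (Pred; _≐_; Decidable)
open import Relation.Binary.Definitions using (DecidableEquality)
open import Relation.Binary.Structures using (IsStrictPartialOrder)
open import Relation.Binary.PropositionalEquality
  using (_≡_; _≢_; refl; sym; trans; cong; cong₂; subst; subst₂)
open import Relation.Binary.Construct.Closure.ReflexiveTransitive using (ε; _◅_; _◅◅_)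

-- Soundness of rewriting

map-agree : ∀ {A B : Set} {n} {f g : A → B} (xs : Vec A n) →
            (∀ {x} → x ∈ toList xs → f x ≡ g x) → Vec.map f xs ≡ Vec.map g xs
map-agree []       f≗g = refl
map-agree (x ∷ xs) f≗g = cong₂ _∷_ (f≗g (here refl)) (map-agree xs (f≗g ∘ there))

module Assignment (V : Vocabulary) where
  open Vocabulary V

  _[_:=_] : ∀ {A : Set} → (NV → A) → NV → A → NV → A
  (π [ z := e ]) u with u ≟ᵛ z
  ... | yes _ = e
  ... | no  _ = π u

  update-at : ∀ {A : Set} {π : NV → A} z {e} → (π [ z := e ]) z ≡ e
  update-at z with z ≟ᵛ z
  ... | yes _  = refl
  ... | no z≢z = contradiction refl z≢z

  update-off : ∀ {A : Set} {π : NV → A} {z u e} → u ≢ z → π u ≡ (π [ z := e ]) u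
  update-off {z = z} {u} u≢z with u ≟ᵛ z
  ... | yes u≡z = contradiction u≡z u≢z
  ... | no  _   = refl

module _ {V : Vocabulary} where
  open Vocabulary V
  open Assignment V

  head⊆vars : ∀ {n} (q : CQ V n) {u} → u ∈ toList (CQ.head q) → u ∈ vars q
  head⊆vars q = ∈-++⁺ˡ

  body⊆vars : ∀ {n} (q : CQ V n) {u α} → α ∈ CQ.body q → u ∈ atomVars α → u ∈ vars q
  body⊆vars q α∈ u∈ = ∈-++⁺ʳ (toList (CQ.head q)) (∈-concatMap⁺ atomVars (lose α∈ u∈))

  vars-cases : ∀ {n} (q : CQ V n) {u} → u ∈ vars q →
               u ∈ toList (CQ.head q) ⊎ (∃ λ α → α ∈ CQ.body q × u ∈ atomVars α)
  vars-cases q u∈ with ∈-++⁻ (toList (CQ.head q)) u∈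
  ... | inj₁ u∈head = inj₁ u∈head
  ... | inj₂ u∈body = inj₂ (find (∈-concatMap⁻ atomVars {xs = CQ.body q} u∈body))

  substᵛ-≢ : ∀ {x y} → x ≢ y → ∀ u → substᵛ {V} x y u ≢ x
  substᵛ-≢ {x} x≢y u with u ≟ᵛ x
  ... | yes _  = λ y≡x → x≢y (sym y≡x)
  ... | no u≢x = u≢x

  substᵛ-cases : ∀ x y u → substᵛ {V} x y u ≡ y ⊎ substᵛ {V} x y u ≡ u
  substᵛ-cases x y u with u ≟ᵛ x
  ... | yes _ = inj₁ refl
  ... | no  _ = inj₂ refl

  substᵛ-merged : ∀ {A : Set} {π : NV → A} {x y} → π x ≡ π y → ∀ u → π (substᵛ {V} x y u) ≡ π u
  substᵛ-merged {x = x} πx≡πy u with u ≟ᵛ x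
  ... | yes refl = sym πx≡πy
  ... | no  _    = refl

  substᵃ-vars : ∀ x y α {u} → u ∈ atomVars (substᵃ {V} x y α) → ∃ λ v → v ∈ atomVars α × u ≡ substᵛ {V} x y v
  substᵃ-vars x y (concept A w) (here refl)         = w , here refl , refl
  substᵃ-vars x y (role r w v)  (here refl)         = w , here refl , refl
  substᵃ-vars x y (role r w v)  (there (here refl)) = v , there (here refl) , refl
  substᵃ-vars x y (equal (var w) (var v)) (here refl)         = w , here refl , refl
  substᵃ-vars x y (equal (var w) (var v)) (there (here refl)) = v , there (here refl) , refl
  substᵃ-vars x y (equal (var w) (ind a)) (here refl)         = w , here refl , refl
  substᵃ-vars x y (equal (ind a) (var v)) (here refl)         = v , here refl , refl

  identify-vars : ∀ {n} (q : CQ V n) x y {u} → u ∈ vars (q [ x ↦ y ]) →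
                  ∃ λ v → v ∈ vars q × u ≡ substᵛ {V} x y v
  identify-vars q x y u∈ with vars-cases (q [ x ↦ y ]) u∈
  ... | inj₁ u∈head
    with v , v∈ , refl ← ∈-map⁻ (substᵛ {V} x y)
           (subst (_ ∈_) (toList-map (substᵛ {V} x y) (CQ.head q)) u∈head)
    = v , head⊆vars q v∈ , refl
  ... | inj₂ (β , β∈ , u∈β)
    with α , α∈ , refl ← ∈-map⁻ (substᵃ {V} x y) (proj₁ (∈-filter⁻ (λ α → ¬? (trivial? {V} α)) β∈))
    with v , v∈ , refl ← substᵃ-vars x y α u∈β
    = v , body⊆vars q α∈ v∈ , refl

  module _ (I : Interpretation V) where
    open Interpretation I

    term-agree : ∀ {π π′} t → (∀ {u} → u ∈ termVars t → π u ≡ π′ u) → ⟦_⟧ᵗ I π t ≡ ⟦_⟧ᵗ I π′ t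
    term-agree (var x) agree = agree (here refl)
    term-agree (ind a) agree = refl

    atom-agree : ∀ {π π′} α → (∀ {u} → u ∈ atomVars α → π u ≡ π′ u) →
                 SatisfiesAtom I π α → SatisfiesAtom I π′ α
    atom-agree (concept A x) agree = subst (concᴵ A) (agree (here refl))
    atom-agree (role r x y)  agree rxy
      rewrite agree (here refl) | agree (there (here refl)) = rxy
    atom-agree (equal t u)   agree t≡u =
      trans (sym (term-agree t (agree ∘ ∈-++⁺ˡ)))
            (trans t≡u (term-agree u (agree ∘ ∈-++⁺ʳ (termVars t))))

    term-subst : ∀ {π} x y t → ⟦_⟧ᵗ I π (substᵗ {V} x y t) ≡ ⟦_⟧ᵗ I (π ∘ substᵛ {V} x y) t
    term-subst x y (var u) = refl
    term-subst x y (ind a) = refl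

    atom-subst⁻ : ∀ {π} x y α → SatisfiesAtom I π (substᵃ x y α) → SatisfiesAtom I (π ∘ substᵛ {V} x y) α
    atom-subst⁻ x y (concept A u) h = h
    atom-subst⁻ x y (role r u v)  h = h
    atom-subst⁻ x y (equal t u)   h = trans (sym (term-subst x y t)) (trans h (term-subst x y u))

    atom-subst⁺ : ∀ {π} x y α → SatisfiesAtom I (π ∘ substᵛ {V} x y) α → SatisfiesAtom I π (substᵃ x y α)
    atom-subst⁺ x y (concept A u) h = h
    atom-subst⁺ x y (role r u v)  h = h
    atom-subst⁺ x y (equal t u)   h = trans (term-subst x y t) (trans h (sym (term-subst x y u)))

    trivial-satisfied : ∀ {π} α → Trivial α → SatisfiesAtom I π α
    trivial-satisfied (equal t u) t≡u = cong (⟦_⟧ᵗ I _) t≡u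

    module _ {T : TBox V} (axioms : ∀ {α} → α ∈ T → I ⊨ᵃˣ α) (Z : FreshVariable V) where

      -- A step that replaces `α` keeps every other atom of `q`, so undoing it only requires that
      -- `α` follow from `βs`.
      restore : ∀ {n} (q : CQ V n) {π α βs} →
                (∀ {β} → β ∈ CQ.body (q [ α ≔ βs ]) → SatisfiesAtom I π β) →
                ((∀ {β} → β ∈ βs → SatisfiesAtom I π β) → SatisfiesAtom I π α) →
                ∀ {γ} → γ ∈ CQ.body q → SatisfiesAtom I π γ
      restore q {α = α} sat step {γ} γ∈ with γ ≟ᵃ α
      ... | yes refl = step (sat ∘ ∈-++⁺ʳ _)
      ... | no  γ≢α  = sat (∈-++⁺ˡ (∈-filter⁺ (λ γ → ¬? (γ ≟ᵃ α)) γ∈ γ≢α))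

      step-sound : ∀ {n as} {q q′ : CQ V n} → Step Z T q q′ → I ⊨ q′ ⟨ as ⟩ → I ⊨ q ⟨ as ⟩
      step-sound {q = q} (s1 ax _) (π , hd , sat) =
        π , hd , restore q sat λ h → axioms ax (h (here refl))
      step-sound {q = q} (s2 {A} {r} {x} {y} ax rxy∈ y∉head (x≢y , only)) (π , hd , sat) =
        -- Neither the head nor any other atom mentions `y`, so `y` may be sent to the successor
        -- that `A ⊑∃ r` yields.
        π [ y := e ] , trans (sym head-agree) hd , sat′
        where
        witness = axioms ax (sat (∈-++⁺ʳ _ (here refl)))
        e = proj₁ witness
        head-agree : Vec.map π (CQ.head q) ≡ Vec.map (π [ y := e ]) (CQ.head q)
        head-agree = map-agree (CQ.head q) λ u∈ → update-off λ { refl → y∉head u∈ }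
        sat′ : ∀ {γ} → γ ∈ CQ.body q → SatisfiesAtom I (π [ y := e ]) γ
        sat′ {γ} γ∈ with γ ≟ᵃ role r x y
        ... | yes refl rewrite update-at {π = π} y {e} | sym (update-off {π = π} {e = e} x≢y) = proj₂ witness
        ... | no  γ≢   = atom-agree γ (λ u∈ → update-off λ { refl → γ≢ (only γ∈ u∈) })
                           (sat (∈-++⁺ˡ (∈-filter⁺ (λ γ → ¬? (γ ≟ᵃ role r x y)) γ∈ γ≢)))
      step-sound {q = q} (s3 ax _) (π , hd , sat) =
        π , hd , restore q sat λ h → axioms ax (_ , h (here refl))
      step-sound {q = q} (s4 ax _) (π , hd , sat) =
        π , hd , restore q sat λ h → axioms ax (h (here refl))
      step-sound {q = q} (s5 ax _) (π , hd , sat) =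
        π , hd , restore q sat λ h → axioms ax (h (here refl))
      step-sound {q = q} (s6 ax _) (π , hd , sat) =
        π , hd , restore q sat λ h → axioms ax (h (here refl)) (h (there (here refl)))
      step-sound {q = q} (s7 {x} {y} _ _) (π , hd , sat) =
        π ∘ substᵛ {V} x y , trans (map-∘ π (substᵛ {V} x y) (CQ.head q)) hd , sat′
        where
        sat′ : ∀ {γ} → γ ∈ CQ.body q → SatisfiesAtom I (π ∘ substᵛ {V} x y) γ
        sat′ {γ} γ∈ with trivial? (substᵃ x y γ)
        -- This atom was dropped from the substituted query, but it is an equality between identical
        -- terms.
        ... | yes t = atom-subst⁻ {π} x y γ (trivial-satisfied (substᵃ x y γ) t)
        ... | no ¬t = atom-subst⁻ {π} x y γ
                        (sat (∈-filter⁺ (λ α → ¬? (trivial? α)) (∈-map⁺ (substᵃ x y) γ∈) ¬t))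

      rew-sound : ∀ {n as} {q q′ : CQ V n} → rew Z T q q′ → I ⊨ q′ ⟨ as ⟩ → I ⊨ q ⟨ as ⟩
      rew-sound ε        = id
      rew-sound (s ◅ ss) = step-sound s ∘ rew-sound ss

-- The chase

module _ (V : Vocabulary) where
  open Vocabulary V

  -- All of NI is included, so that the chase interprets every individual.
  data Point : Set where
    named : NI → Point
    child : Point → NR → Point

module _ {V : Vocabulary} where
  open Vocabulary V

  named-injective : ∀ {a b} → _≡_ {A = Point V} (named a) (named b) → a ≡ b
  named-injective refl = refl

  _≟ᵖ_ : DecidableEquality (Point V)
  named a   ≟ᵖ named b   = map′ (cong named) named-injective (a ≟ⁱ b)
  named _   ≟ᵖ child _ _ = no λ ()
  child _ _ ≟ᵖ named _   = no λ ()
  child d r ≟ᵖ child e s =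
    map′ (λ { (refl , refl) → refl }) (λ { refl → refl , refl }) (d ≟ᵖ e ×-dec r ≟ʳ s)

  depth : Point V → ℕ
  depth (named _)   = 0
  depth (child d _) = suc (depth d)

  deepest : (π : NV → Point V) (xs : List NV) →
            (∀ {x} → x ∈ xs → ∃ λ a → π x ≡ named a) ⊎
            (∃ λ y → y ∈ xs × (∃₂ λ d r → π y ≡ child d r)
                            × (∀ {x} → x ∈ xs → depth (π x) ≤ depth (π y)))
  deepest π [] = inj₁ λ ()
  deepest π (x ∷ xs) with π x in eq | deepest π xs
  ... | named a | inj₁ h = inj₁ λ { (here refl) → a , eq ; (there x∈) → h x∈ }
  ... | named a | inj₂ (y , y∈ , πy , max) =
    inj₂ (y , there y∈ , πy , λ { (here refl) → ℕ.≤-trans (ℕ.≤-reflexive (cong depth eq)) z≤n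
                                ; (there x∈) → max x∈ })
  ... | child d r | inj₁ h = inj₂ (x , here refl , (d , r , eq) , λ where
    (here refl) → ℕ.≤-refl
    (there x∈)  → ℕ.≤-trans (ℕ.≤-reflexive (cong depth (proj₂ (h x∈)))) z≤n)
  ... | child d r | inj₂ (y , y∈ , πy , max) with ℕ.≤-total (depth (π y)) (depth (π x))
  ... | inj₁ y≤x = inj₂ (x , here refl , (d , r , eq) , λ where
    (here refl) → ℕ.≤-refl
    (there x∈)  → ℕ.≤-trans (max x∈) y≤x)
  ... | inj₂ x≤y = inj₂ (y , there y∈ , πy , λ { (here refl) → x≤y ; (there x∈) → max x∈ })

  -- Conjunctions with the total size of their derivations

  data Weighted (P : Atom V → ℕ → Set) : List (Atom V) → ℕ → Set where
    []  : Weighted P [] 0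
    _∷_ : ∀ {α φ m n} → P α m → Weighted P φ n → Weighted P (α ∷ φ) (m + n)

  lookup-weighted : ∀ {P φ n α} → Weighted P φ n → α ∈ φ → ∃ (P α)
  lookup-weighted (d ∷ ds) (here refl) = _ , d
  lookup-weighted (d ∷ ds) (there α∈)  = lookup-weighted ds α∈

  module _ {P : Atom V → ℕ → Set} where

    ++-weighted : ∀ {φ ψ m n} → Weighted P φ m → Weighted P ψ n → Weighted P (φ ++ ψ) (m + n)
    ++-weighted []                  w = w
    ++-weighted (_∷_ {m = k} d ds) w = subst (Weighted P _) (sym (ℕ.+-assoc k _ _)) (d ∷ ++-weighted ds w)

    tabulate-weighted : ∀ φ → (∀ {α} → α ∈ φ → ∃ (P α)) → ∃ (Weighted P φ)
    tabulate-weighted []      h = _ , []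
    tabulate-weighted (α ∷ φ) h = _ , proj₂ (h (here refl)) ∷ proj₂ (tabulate-weighted φ (h ∘ there))

    filter-weighted : ∀ {p} {R : Pred (Atom V) p} (R? : Decidable R) {φ n} → Weighted P φ n →
                      ∃ λ k → Weighted P (filter R? φ) k × k ≤ n
    filter-weighted R? [] = 0 , [] , z≤n
    filter-weighted R? (_∷_ {α} {m = m} d ds) with R? α | filter-weighted R? ds
    ... | yes _ | k , ds′ , k≤n = m + k , d ∷ ds′ , ℕ.+-monoʳ-≤ m k≤n
    ... | no  _ | k , ds′ , k≤n = k , ds′ , ℕ.≤-trans k≤n (ℕ.m≤n+m _ m)

    map-weighted : ∀ {Q φ n} → (∀ {α m} → α ∈ φ → P α m → Q α m) → Weighted P φ n → Weighted Q φ n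
    map-weighted f []       = []
    map-weighted f (d ∷ ds) = f (here refl) d ∷ map-weighted (f ∘ there) ds

    -- An inequality, because deleting `α` removes all its copies while only one derivation of size
    -- `m` is charged for it.
    Without : Atom V → List (Atom V) → ℕ → ℕ → Set
    Without α φ m n = ∃ λ k → Weighted P (filter (λ γ → ¬? (γ ≟ᵃ α)) φ) k × m + k ≤ n

    without-∷ : ∀ {α β φ k m n} → P β k → Without α φ m n → Without α (β ∷ φ) m (k + n)
    without-∷ {α} {β} {φ} {k} {m} {n} d (l , w , le) = case β ≟ᵃ α of λ where
        (yes β≡α) → l , subst (λ ψ → Weighted P ψ l) (sym (filter-reject ≢α? (λ β≢α → β≢α β≡α))) w
                      , ℕ.≤-trans le (ℕ.m≤n+m n k)
        (no β≢α)  → k + l , subst (λ ψ → Weighted P ψ (k + l)) (sym (filter-accept ≢α? β≢α)) (d ∷ w) , bound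
      where
      ≢α? = λ γ → ¬? (γ ≟ᵃ α)
      bound : m + (k + l) ≤ k + n
      bound rewrite sym (ℕ.+-assoc m k l) | ℕ.+-comm m k | ℕ.+-assoc k m l = ℕ.+-monoʳ-≤ k le

    -- The first atom with `Q` comes with the weight left for the others, which a rewriting step
    -- that replaces this atom needs for its measure.
    scan : ∀ {Q R : Atom V → ℕ → Set} {φ n} → (∀ {α m} → α ∈ φ → P α m → Q α m ⊎ R α m) →
           Weighted P φ n → (∃₂ λ α m → α ∈ φ × Q α m × Without α φ m n) ⊎ Weighted R φ n
    scan f [] = inj₂ []
    scan f (_∷_ {β} {m = k} d ds) with f (here refl) d
    ... | inj₁ q
      with l , w , l≤n ← filter-weighted (λ γ → ¬? (γ ≟ᵃ β)) ds
      = inj₁ (β , k , here refl , q , l , subst (λ ψ → Weighted P ψ l) (sym reject) w , ℕ.+-monoʳ-≤ k l≤n)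
      where reject = filter-reject (λ γ → ¬? (γ ≟ᵃ β)) (λ β≢β → β≢β refl)
    scan f (_∷_ {β} {n = n} d ds) | inj₂ r with scan (f ∘ there) ds
    ... | inj₂ rs = inj₂ (r ∷ rs)
    ... | inj₁ (α , m , α∈ , q , rest) = inj₁ (α , m , there α∈ , q , without-∷ d rest)

    extract : ∀ {φ n α} → Weighted P φ n → α ∈ φ → ∃ λ m → P α m × Without α φ m n
    extract {α = α} w α∈
      with scan {Q = λ β m → β ≡ α × P α m} {R = λ β _ → β ≢ α} (λ _ → split) w
      where
      split : ∀ {β m} → P β m → (β ≡ α × P α m) ⊎ β ≢ α
      split {β} d with β ≟ᵃ α
      ... | yes refl = inj₁ (refl , d)
      ... | no  β≢α  = inj₂ β≢α
    ... | inj₁ (_ , m , _ , (refl , d) , rest) = m , d , rest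
    ... | inj₂ ws = contradiction refl (proj₂ (lookup-weighted ws α∈))

  pointInterpretation : (NC → Point V → Set) → (NR → Point V → Point V → Set) → Interpretation V
  pointInterpretation C R = record
    { structure = record { Δ = Point V ; concᴵ = C ; roleᴵ = R }
    ; indᴵ = named ; injective = named-injective }

  -- Equalities mention neither concepts nor roles; the case split only lets `⟦_⟧ᵗ` compute.
  equal-transfer : ∀ {C C′ R R′ π} t u →
    SatisfiesAtom (pointInterpretation C R) π (equal t u) → SatisfiesAtom (pointInterpretation C′ R′) π (equal t u)
  equal-transfer (var _) (var _) = id
  equal-transfer (var _) (ind _) = id
  equal-transfer (ind _) (var _) = id
  equal-transfer (ind _) (ind _) = id

  -- Sized derivations in the chase

  module _ (T : TBox V) (𝒜 : ABox V) where

    -- The number counts the uses of axioms. A successor is named by its parent and role alone, so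
    -- all axioms `A ⊑∃ r` share `child d r`, and the edge generating a point can be read off it.
    mutual
      data Chaseᶜ : NC → Point V → ℕ → Set where
        assertion : ∀ {A a} → conceptA A a ∈ 𝒜 → Chaseᶜ A (named a) 0
        inclusion : ∀ {A B d m} → (A ⊑ᶜ B) ∈ T → Chaseᶜ A d m → Chaseᶜ B d (suc m)
        exists    : ∀ {r A d e m} → (∃ r ⊑ A) ∈ T → Chaseʳ r d e m → Chaseᶜ A d (suc m)

      data Chaseʳ : NR → Point V → Point V → ℕ → Set where
        assertion   : ∀ {p a b} → roleA p a b ∈ 𝒜 → Chaseʳ p (named a) (named b) 0
        witness     : ∀ {A r d m} → (A ⊑∃ r) ∈ T → Chaseᶜ A d m → Chaseʳ r d (child d r) (suc m)
        inclusion   : ∀ {r s d e m} → (r ⊑ʳ s) ∈ T → Chaseʳ r d e m → Chaseʳ s d e (suc m)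
        inclusion⁻  : ∀ {r s d e m} → (r ⊑ʳ s ⁻) ∈ T → Chaseʳ r d e m → Chaseʳ s e d (suc m)
        composition : ∀ {r s t d e f m n} → (r · s ⊑ t) ∈ T →
                      Chaseʳ r d e m → Chaseʳ s e f n → Chaseʳ t d f (suc (m + n))

    chase : Interpretation V
    chase = pointInterpretation (λ A d → ∃ (Chaseᶜ A d)) (λ r d e → ∃ (Chaseʳ r d e))

    -- Fixing the size turns the facts with a derivation of that size into an
    -- interpretation, to which the lemmas on SatisfiesAtom apply.
    chaseAt : ℕ → Interpretation V
    chaseAt m = pointInterpretation (λ A d → Chaseᶜ A d m) (λ r d e → Chaseʳ r d e m)

    Assertedᶜ : NC → Point V → Set
    Assertedᶜ A d = ∃ λ a → d ≡ named a × conceptA A a ∈ 𝒜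

    Assertedʳ : NR → Point V → Point V → Set
    Assertedʳ r d e = ∃₂ λ a b → d ≡ named a × e ≡ named b × roleA r a b ∈ 𝒜

    -- The derivation of `A` at `d` is strictly smaller, so that `s2`, which puts `A(x)` for
    -- `r(x,y)`, lowers the total size.
    Generated : NR → Point V → Point V → ℕ → Set
    Generated r d e m = e ≡ child d r × ∃₂ λ A k → (A ⊑∃ r) ∈ T × Chaseᶜ A d k × k < m

    leafAt : ℕ → Interpretation V
    leafAt m = pointInterpretation
      (λ A d → Chaseᶜ A d m × Assertedᶜ A d)
      (λ r d e → Chaseʳ r d e m × (Assertedʳ r d e ⊎ Generated r d e m))

    Derived Leaf : (NV → Point V) → Atom V → ℕ → Set
    Derived π α m = SatisfiesAtom (chaseAt m) π α
    Leaf    π α m = SatisfiesAtom (leafAt m) π α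

    leaf-derived : ∀ {π} α {m} → Leaf π α m → Derived π α m
    leaf-derived (concept A x) = proj₁
    leaf-derived (role r x y)  = proj₁
    leaf-derived (equal t u)   = equal-transfer t u

  -- Completeness of rewriting for the chase

  replace-< : ∀ {j k m} l → j < m → m + l ≤ k → l + j < k
  replace-< {m = m} l j<m m+l≤k =
    ℕ.<-≤-trans (ℕ.+-monoʳ-< l j<m) (ℕ.≤-trans (ℕ.≤-reflexive (ℕ.+-comm l m)) m+l≤k)

  module Completeness (T : TBox V) (𝒜 : ABox V) (Z : FreshVariable V) {n : ℕ} (as : Vec NI n) where
    open FreshVariable Z
    open Assignment V

    Answers : CQ V n → Set₁
    Answers q = ∀ I → IsModel I [] 𝒜 → I ⊨ q ⟨ as ⟩

    HeadAt : (NV → Point V) → CQ V n → Set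
    HeadAt π q = Vec.map π (CQ.head q) ≡ Vec.map named as

    -- `s3` and `s6` introduce `z q`, which must denote a point that occurs only inside the
    -- derivation; hence a second match `π′`, which may differ from `π` outside `vars q`.
    Reduct : CQ V n → (NV → Point V) → Atom V → ℕ → Set
    Reduct q π α m = ∃ λ βs → ∃₂ λ π′ k →
      Step Z T q (q [ α ≔ βs ]) × k < m × (∀ {u} → u ∈ vars q → π u ≡ π′ u) × Weighted (Derived T 𝒜 π′) βs k

    module _ (q : CQ V n) {π : NV → Point V} where

      keep : ∀ {α β m k} → Step Z T q (q [ α ≔ β ∷ [] ]) → k < m → Derived T 𝒜 π β k → Reduct q π α m
      keep {k = k} st k<m d =
        _ , π , _ , st , subst (_< _) (sym (ℕ.+-identityʳ k)) k<m , (λ _ → refl) , d ∷ []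

      module _ (e : Point V) where

        at-fresh : e ≡ (π [ z q := e ]) (z q)
        at-fresh = sym (update-at {π = π} (z q))

        off-fresh : ∀ {u} → u ∈ vars q → π u ≡ (π [ z q := e ]) u
        off-fresh u∈ = update-off {π = π} λ { refl → fresh q u∈ }

      -- An equation keeps `d` apart from `π x`, since a derivation indexed by `π x` could not be
      -- matched against `named a`.
      expandᶜ : ∀ {A x d m} → concept A x ∈ CQ.body q → Chaseᶜ T 𝒜 A d m → π x ≡ d →
                Reduct q π (concept A x) m ⊎ Assertedᶜ T 𝒜 A d
      expandᶜ α∈ (assertion A∈) _       = inj₂ (_ , refl , A∈)
      expandᶜ α∈ (inclusion ax d) refl = inj₁ (keep (s1 ax α∈) ℕ.≤-refl d)
      expandᶜ {x = x} α∈ (exists {r} {e = e} {m} ax d) refl = inj₁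
        ( _ , π [ z q := e ] , _ , s3 ax α∈ , s≤s (ℕ.≤-reflexive (ℕ.+-identityʳ m)) , off-fresh e
        , subst₂ (λ d e → Chaseʳ T 𝒜 r d e m) (off-fresh e (body⊆vars q α∈ (here refl))) (at-fresh e) d ∷ [] )

      expandʳ : ∀ {r x y d e m} → role r x y ∈ CQ.body q → Chaseʳ T 𝒜 r d e m → π x ≡ d → π y ≡ e →
                Reduct q π (role r x y) m ⊎ (Assertedʳ T 𝒜 r d e ⊎ Generated T 𝒜 r d e m)
      expandʳ α∈ (assertion r∈) _ _         = inj₂ (inj₁ (_ , _ , refl , refl , r∈))
      -- Undoing a witness needs `y` to occur nowhere else, so it is postponed as a leaf.
      expandʳ α∈ (witness ax d) _ _           = inj₂ (inj₂ (refl , _ , _ , ax , d , ℕ.≤-refl))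
      expandʳ α∈ (inclusion ax d) refl refl   = inj₁ (keep (s4 ax α∈) ℕ.≤-refl d)
      expandʳ α∈ (inclusion⁻ ax d) refl refl = inj₁ (keep (s5 ax α∈) ℕ.≤-refl d)
      expandʳ {x = x} {y} α∈ (composition {r} {s} {e = e} {m = m} {k} ax d d′) refl refl = inj₁
        ( _ , π [ z q := e ] , _ , s6 ax α∈ , s≤s (ℕ.≤-reflexive (cong (m +_) (ℕ.+-identityʳ k))) , off-fresh e
        , subst₂ (λ d e → Chaseʳ T 𝒜 r d e m) (off-fresh e (body⊆vars q α∈ (here refl))) (at-fresh e) d
        ∷ subst₂ (λ d e → Chaseʳ T 𝒜 s d e k) (at-fresh e) (off-fresh e (body⊆vars q α∈ (there (here refl)))) d′
        ∷ [] )

      expand : ∀ {α m} → α ∈ CQ.body q → Derived T 𝒜 π α m → Reduct q π α m ⊎ Leaf T 𝒜 π α m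
      expand {concept A x} α∈ d with expandᶜ α∈ d refl
      ... | inj₁ red  = inj₁ red
      ... | inj₂ leaf = inj₂ (d , leaf)
      expand {role r x y} α∈ d with expandʳ α∈ d refl refl
      ... | inj₁ red  = inj₁ red
      ... | inj₂ leaf = inj₂ (d , leaf)
      expand {equal t u} α∈ d = inj₂ (equal-transfer t u d)

    NoTrivial : CQ V n → Set
    NoTrivial q = ∀ {α} → α ∈ CQ.body q → ¬ Trivial α

    InjectiveOn : (NV → Point V) → List NV → Set
    InjectiveOn π xs = ∀ {x y} → x ∈ xs → y ∈ xs → π x ≡ π y → x ≡ y

    module _ {π : NV → Point V} where

      map-subst-weighted : ∀ {x y φ k} → π x ≡ π y → Weighted (Leaf T 𝒜 π) φ k →
                           Weighted (Leaf T 𝒜 π) (map (substᵃ x y) φ) k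
      map-subst-weighted πx≡πy [] = []
      map-subst-weighted {x} {y} πx≡πy (_∷_ {α} {m = m} d ds) =
        atom-subst⁺ (leafAt T 𝒜 m) {π} x y α
          (atom-agree (leafAt T 𝒜 m) α (λ {u} _ → sym (substᵛ-merged {π = π} πx≡πy u)) d)
        ∷ map-subst-weighted πx≡πy ds

      identify : ∀ (q : CQ V n) {x y k} → π x ≡ π y → HeadAt π q → Weighted (Leaf T 𝒜 π) (CQ.body q) k →
                 HeadAt π (q [ x ↦ y ]) × NoTrivial (q [ x ↦ y ]) ×
                 ∃ λ l → Weighted (Leaf T 𝒜 π) (CQ.body (q [ x ↦ y ])) l × l ≤ k
      identify q {x} {y} πx≡πy hd w =
          trans (sym (map-∘ π (substᵛ {V} x y) (CQ.head q)))
                (trans (map-agree (CQ.head q) (λ {u} _ → substᵛ-merged {π = π} πx≡πy u)) hd)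
        , (λ α∈ → proj₂ (∈-filter⁻ (λ α → ¬? (trivial? α)) {xs = map (substᵃ x y) (CQ.body q)} α∈))
        , filter-weighted (λ α → ¬? (trivial? α)) (map-subst-weighted πx≡πy w)

      -- Each use of `s7` eliminates `x` from the query. The list `L` covers the variables and loses
      -- `x` as well, so its length decreases.
      separate : (q : CQ V n) (L : List NV) → Acc _<_ (length L) → (∀ {u} → u ∈ vars q → u ∈ L) →
                 ∀ {k} → HeadAt π q → NoTrivial q → Weighted (Leaf T 𝒜 π) (CQ.body q) k →
                 ∃₂ λ q′ l → rew Z T q q′ × HeadAt π q′ × NoTrivial q′ ×
                   Weighted (Leaf T 𝒜 π) (CQ.body q′) l × l ≤ k × InjectiveOn π (vars q′)
      separate q L (acc rs) ⊆L {k} hd nt w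
        with any? (λ x → any? (λ y → (π x ≟ᵖ π y) ×-dec ¬? (x ≟ᵛ y)) (vars q)) (vars q)
      ... | no none = q , k , ε , hd , nt , w , ℕ.≤-refl , λ {x} {y} x∈ y∈ πx≡πy →
              decidable-stable (x ≟ᵛ y) λ x≢y → none (lose x∈ (lose y∈ (πx≡πy , x≢y)))
      ... | yes some
        with x , x∈ , some′ ← find some
        with y , y∈ , πx≡πy , x≢y ← find some′
        with hd′ , nt′ , l , w′ , l≤k ← identify q πx≡πy hd w
        with q″ , j , ss , hd″ , nt″ , w″ , j≤l , inj ← separate (q [ x ↦ y ]) (filter (λ u → ¬? (u ≟ᵛ x)) L)
          (rs (filter-notAll (λ u → ¬? (u ≟ᵛ x)) L (lose (⊆L x∈) λ x≢x → x≢x refl)))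
          (λ u∈ → case identify-vars q x y u∈ of λ where
            (v , v∈ , refl) → ∈-filter⁺ (λ u → ¬? (u ≟ᵛ x))
              (⊆L ([ (λ ≡y → subst (_∈ vars q) (sym ≡y) y∈) , (λ ≡v → subst (_∈ vars q) (sym ≡v) v∈) ]′
                (substᵛ-cases x y v)))
              (substᵛ-≢ x≢y v))
          hd′ nt′ w′
        = q″ , j , s7 x∈ y∈ ◅ ss , hd″ , nt″ , w″ , ℕ.≤-trans j≤l l≤k , inj

      -- A generated edge would end in a child, so every concept or role atom is an assertion and
      -- holds in every model of the ABox.
      all-named : (q : CQ V n) {k : ℕ} → HeadAt π q → Weighted (Leaf T 𝒜 π) (CQ.body q) k →
                  (∀ {x} → x ∈ vars q → ∃ λ a → π x ≡ named a) → Answers q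
      all-named q hd w isNamed I model = ⌊_⌋ ∘ π , hd′ , sat
        where
        open Interpretation I
        open IsModel model
        ⌊_⌋ : Point V → Δ
        ⌊ named a ⌋   = indᴵ a
        -- No variable of `q` denotes a child; this clause only makes the map total.
        ⌊ child d _ ⌋ = ⌊ d ⌋
        hd′ : Vec.map (⌊_⌋ ∘ π) (CQ.head q) ≡ Vec.map indᴵ as
        hd′ = trans (map-∘ ⌊_⌋ π (CQ.head q)) (trans (cong (Vec.map ⌊_⌋) hd) (sym (map-∘ ⌊_⌋ named as)))
        value : ∀ {m} t → ⟦_⟧ᵗ I (⌊_⌋ ∘ π) t ≡ ⌊ ⟦_⟧ᵗ (leafAt T 𝒜 m) π t ⌋
        value (var x) = refl
        value (ind a) = refl
        sat : ∀ {α} → α ∈ CQ.body q → SatisfiesAtom I (⌊_⌋ ∘ π) α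
        sat {concept A x} α∈ with lookup-weighted w α∈
        ... | _ , _ , a , x≡a , A∈ rewrite x≡a = assertions A∈
        sat {role r x y} α∈ with lookup-weighted w α∈
        ... | _ , _ , inj₁ (a , b , x≡a , y≡b , r∈) rewrite x≡a | y≡b = assertions r∈
        ... | _ , _ , inj₂ (y≡child , _) with _ , y≡b ← isNamed (body⊆vars q α∈ (there (here refl)))
          = case trans (sym y≡child) y≡b of λ ()
        sat {equal t u} α∈ with m , t≡u ← lookup-weighted w α∈ =
          trans (value {m} t) (trans (cong ⌊_⌋ t≡u) (sym (value {m} u)))

      module _ (q : CQ V n) {k : ℕ} (hd : HeadAt π q) (nontrivial : NoTrivial q)
               (w : Weighted (Leaf T 𝒜 π) (CQ.body q) k) (inj : InjectiveOn π (vars q)) where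

        -- Between two variables, injectivity of the match would make the equality trivial; between
        -- a variable and an individual, the variable would be named.
        equal-anonymous : ∀ {t u y d r} → equal t u ∈ CQ.body q → π y ≡ child d r → ¬ y ∈ atomVars (equal t u)
        equal-anonymous {var x} {var y} α∈ _ _ with _ , x≡y ← lookup-weighted w α∈ =
          nontrivial α∈ (cong var (inj (body⊆vars q α∈ (here refl)) (body⊆vars q α∈ (there (here refl))) x≡y))
        equal-anonymous {var x} {ind a} α∈ πy (here refl) with _ , x≡a ← lookup-weighted w α∈ =
          case trans (sym πy) x≡a of λ ()
        equal-anonymous {ind a} {var x} α∈ πy (here refl) with _ , a≡x ← lookup-weighted w α∈ =
          case trans a≡x πy of λ ()
        equal-anonymous {ind a} {ind b} α∈ πy ()

        -- Asserted atoms have named arguments only, and a generated edge leaving `y` would lead to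
        -- a deeper variable. What remains is an edge into `y`, whose role and source are fixed by
        -- the point `child d r`.
        deepest-atom : ∀ {y d r α} → π y ≡ child d r → (∀ {x} → x ∈ vars q → depth (π x) ≤ depth (π y)) →
                       α ∈ CQ.body q → y ∈ atomVars α → ∃ λ x → α ≡ role r x y × π x ≡ d
        deepest-atom {α = concept A x} πy max α∈ (here refl)
          with _ , _ , a , x≡a , _ ← lookup-weighted w α∈ = case trans (sym πy) x≡a of λ ()
        deepest-atom {α = role s u v} πy max α∈ y∈ with lookup-weighted w α∈
        deepest-atom {α = role s u v} πy max α∈ (here refl)         | _ , _ , inj₁ (_ , _ , u≡a , _) =
          case trans (sym πy) u≡a of λ ()
        deepest-atom {α = role s u v} πy max α∈ (there (here refl)) | _ , _ , inj₁ (_ , _ , _ , v≡b , _) =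
          case trans (sym πy) v≡b of λ ()
        deepest-atom {α = role s u v} πy max α∈ (here refl)         | _ , _ , inj₂ (v≡child , _) =
          contradiction (ℕ.≤-trans (ℕ.≤-reflexive (sym (cong depth v≡child)))
                                   (max (body⊆vars q α∈ (there (here refl)))))
                        ℕ.1+n≰n
        deepest-atom {α = role s u v} πy max α∈ (there (here refl)) | _ , _ , inj₂ (v≡child , _)
          with refl ← trans (sym πy) v≡child = u , refl , refl
        deepest-atom {α = equal t u} πy max α∈ y∈ = ⊥-elim (equal-anonymous {t} {u} α∈ πy y∈)

        -- The deepest variable is ready for `s2`: being anonymous it is no answer variable, and all
        -- atoms that mention it coincide.
        generate : ∀ {y d r} → y ∈ vars q → π y ≡ child d r →
                   (∀ {x} → x ∈ vars q → depth (π x) ≤ depth (π y)) →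
                   ∃₂ λ q′ l → Step Z T q q′ × HeadAt π q′ × Weighted (Derived T 𝒜 π) (CQ.body q′) l × l < k
        generate {y} {d} {r} y∈ πy max = use (vars-cases q y∈)
          where
          named-head : ∀ {m} {xs : Vec NV m} {bs} → Vec.map π xs ≡ Vec.map named bs →
                       ∀ {u} → u ∈ toList xs → ∃ λ a → π u ≡ named a
          named-head {xs = _ ∷ _} {b ∷ _} eq (here refl) = b , proj₁ (∷-injective eq)
          named-head {xs = _ ∷ _} {_ ∷ _} eq (there u∈)  = named-head (proj₂ (∷-injective eq)) u∈

          y∉head : y ∉ toList (CQ.head q)
          y∉head y∈ with _ , πy′ ← named-head hd y∈ = case trans (sym πy) πy′ of λ ()

          use : _ → _
          use (inj₁ y∈head) = contradiction y∈head y∉head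
          use (inj₂ (α , α∈ , y∈α)) with x , refl , πx ← deepest-atom πy max α∈ y∈α
            with extract w α∈
          ... | _ , (_ , inj₁ (_ , _ , _ , y≡b , _)) , _ = case trans (sym πy) y≡b of λ ()
          ... | m , (_ , inj₂ (_ , A , j , ax , c , j<m)) , l , w′ , m+l≤k =
            _ , _ , s2 ax α∈ y∉head (x≢y , only) , hd
            , ++-weighted (map-weighted (λ {γ} _ → leaf-derived T 𝒜 γ) w′) (c ∷ [])
            , subst (λ i → l + i < _) (sym (ℕ.+-identityʳ j)) (replace-< l j<m m+l≤k)
            where
            x≢y : x ≢ y
            x≢y refl = ℕ.1+n≢n (cong depth (trans (sym πy) πx))
            only : ∀ {γ} → γ ∈ CQ.body q → y ∈ atomVars γ → γ ≡ role r x y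
            -- Two edges into `y` start at the same point, hence by injectivity at the same
            -- variable.
            only γ∈ y∈γ with x′ , refl , πx′ ← deepest-atom πy max γ∈ y∈γ =
              cong (λ u → role r u y)
                (inj (body⊆vars q γ∈ (here refl)) (body⊆vars q α∈ (here refl)) (trans πx′ (sym πx)))

    -- The uses of `s7` never raise the size, and the single `s2` after them lowers it strictly,
    -- unless the match is already named throughout.
    settle : ∀ q {π k} → HeadAt π q → Weighted (Leaf T 𝒜 π) (CQ.body q) k →
             (∃ λ q′ → rew Z T q q′ × Answers q′) ⊎
             (∃₂ λ q′ l → rew Z T q q′ × HeadAt π q′ × Weighted (Derived T 𝒜 π) (CQ.body q′) l × l < k)
    settle q {π} hd w with vars q in vars≡
    -- There is no variable for `[ x ↦ x ]` here, but the match is vacuously named.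
    ... | [] = inj₁ (q , ε , all-named q hd w λ x∈ → case subst (_ ∈_) vars≡ x∈ of λ ())
    ... | x ∷ _
      -- Even [ x ↦ x ] is of use: it drops the equalities t = t, which would be
      -- further occurrences of the variable that s2 eliminates.
      with x∈ ← subst (x ∈_) (sym vars≡) (here refl)
      with hd₁ , nt₁ , k₁ , w₁ , k₁≤k ← identify q {x} {x} refl hd w
      with q₂ , k₂ , ss , hd₂ , nt₂ , w₂ , k₂≤k₁ , inj ←
             separate (q [ x ↦ x ]) (vars (q [ x ↦ x ])) (<-wellFounded _) id hd₁ nt₁ w₁
      with deepest π (vars q₂)
    ... | inj₁ isNamed = inj₁ (q₂ , s7 x∈ x∈ ◅ ss , all-named q₂ hd₂ w₂ isNamed)
    ... | inj₂ (y , y∈ , (d , r , πy) , max)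
      with q₃ , k₃ , s , hd₃ , w₃ , k₃<k₂ ← generate q₂ hd₂ nt₂ w₂ inj y∈ πy max
      = inj₂ (q₃ , k₃ , s7 x∈ x∈ ◅ ss ◅◅ (s ◅ ε) , hd₃ , w₃
             , ℕ.<-≤-trans k₃<k₂ (ℕ.≤-trans k₂≤k₁ k₁≤k))

    rewrite-derived : ∀ q {π k} → Acc _<_ k → HeadAt π q → Weighted (Derived T 𝒜 π) (CQ.body q) k →
                      ∃ λ q′ → rew Z T q q′ × Answers q′
    rewrite-derived q {π} {k} (acc rs) hd w with scan (expand q) w
    ... | inj₁ (α , m , _ , (_ , π′ , j , s , j<m , agree , w₁) , l , w₀ , m+l≤k)
      with q′ , ss , ans ← rewrite-derived (q [ α ≔ _ ]) (rs (replace-< l j<m m+l≤k))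
             (trans (sym (map-agree (CQ.head q) (agree ∘ head⊆vars q))) hd)
             (++-weighted (map-weighted (λ {γ} {i} γ∈ → atom-agree (chaseAt T 𝒜 i) γ (agree ∘ body⊆vars q
                                          (proj₁ (∈-filter⁻ (λ γ → ¬? (γ ≟ᵃ α)) γ∈)))) w₀)
                          w₁)
      = q′ , s ◅ ss , ans
    ... | inj₂ leaves with settle q hd leaves
    ...   | inj₁ done = done
    ...   | inj₂ (q₁ , l , ss , hd₁ , w₁ , l<k)
      with q₂ , ss′ , ans ← rewrite-derived q₁ (rs l<k) hd₁ w₁ = q₂ , ss ◅◅ ss′ , ans

    rew-complete : ∀ q → chase T 𝒜 ⊨ q ⟨ as ⟩ → ∃ λ q′ → rew Z T q q′ × Answers q′
    rew-complete q (π , hd , sat) =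
      rewrite-derived q (<-wellFounded _) hd (proj₂ (tabulate-weighted (CQ.body q) (λ {α} → derived α ∘ sat)))
      where
      derived : ∀ α → SatisfiesAtom (chase T 𝒜) π α → ∃ (Derived T 𝒜 π α)
      derived (concept A x) = id
      derived (role r x y)  = id
      -- An equality has no derivation; it is given weight 0.
      derived (equal t u) h = 0 , equal-transfer t u h

-- The unfolded TBox

unique⊆⇒length≤ : ∀ {A : Set} (_≟_ : DecidableEquality A) {xs ys : List A} → Unique xs →
                  (∀ {x} → x ∈ xs → x ∈ ys) → length xs ≤ length ys
unique⊆⇒length≤ _≟_ [] xs⊆ys = z≤n
unique⊆⇒length≤ _≟_ {x ∷ xs} {ys} (x∉xs ∷ uniq) xs⊆ys =
  ℕ.≤-<-trans
    (unique⊆⇒length≤ _≟_ uniq λ y∈ →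
      ∈-filter⁺ (λ y → ¬? (y ≟ x)) (xs⊆ys (there y∈)) λ { refl → All.lookup x∉xs y∈ refl })
    (filter-notAll (λ y → ¬? (y ≟ x)) ys (lose (xs⊆ys (here refl)) λ x≢x → x≢x refl))

module _ {V : Vocabulary} where
  open Vocabulary V

  -- Descending sequences of concept names

  module _ (o : StrictOrder V) where
    open StrictOrder o
    open IsStrictPartialOrder isStrictPartialOrder using (irrefl) renaming (trans to ≺-trans)

    Descending : NC → List NC → Set
    Descending A xs = Linked (swapArgs _≺_) (A ∷ xs)

    descending⊆carrier : ∀ {A xs} → A ∈ carrier → Descending A xs → ∀ {B} → B ∈ A ∷ xs → B ∈ carrier
    descending⊆carrier A∈ _           (here refl) = A∈
    descending⊆carrier A∈ (B≺A ∷ lnk) (there B∈)  = descending⊆carrier (proj₁ (over B≺A)) lnk B∈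

    descending-length : ∀ {A xs} → A ∈ carrier → Descending A xs → length (A ∷ xs) ≤ length carrier
    descending-length A∈ lnk =
      unique⊆⇒length≤ _≟ᶜ_
        (AllPairs.map (λ B≺A A≡B → irrefl (sym A≡B) B≺A) (Linked⇒AllPairs (λ B≺A C≺B → ≺-trans C≺B B≺A) lnk))
        (descending⊆carrier A∈ lnk)

  -- Individuals, and passage to the unfolded vocabulary

  concept-individual : ∀ {𝒜 : ABox V} {A a} → conceptA A a ∈ 𝒜 → a ∈ individuals 𝒜
  concept-individual p = ∈-concatMap⁺ _ (lose p (here refl))

  role-individual₁ : ∀ {𝒜 : ABox V} {r a b} → roleA r a b ∈ 𝒜 → a ∈ individuals 𝒜
  role-individual₁ p = ∈-concatMap⁺ _ (lose p (here refl))

  role-individual₂ : ∀ {𝒜 : ABox V} {r a b} → roleA r a b ∈ 𝒜 → b ∈ individuals 𝒜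
  role-individual₂ p = ∈-concatMap⁺ _ (lose p (there (here refl)))

  individuals-lift : ∀ (𝒜 : ABox V) → individuals (liftABox 𝒜) ≡ individuals 𝒜
  individuals-lift []                  = refl
  individuals-lift (conceptA A a ∷ 𝒜) = cong (a ∷_) (individuals-lift 𝒜)
  individuals-lift (roleA p a b ∷ 𝒜)  = cong (λ as → a ∷ b ∷ as) (individuals-lift 𝒜)

  underlying : UnfoldedRole NR → NR
  underlying (base r)    = r
  underlying (level r _) = r
  underlying (hat r)     = r

  underlying-hatRole : ∀ (T : TBox V) r → underlying (hatRole T r) ≡ r
  underlying-hatRole T r with recursive? T r
  ... | yes _ = refl
  ... | no  _ = refl

  -- The unfolding turns `A ⊑∃ r` into `A ⊑∃ base r`, so its successors are labelled by base roles.
  embed : Point V → Point (unfolded V)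
  embed (named a)   = named a
  embed (child d r) = child (embed d) (base r)

  -- Folding the chase into `ℰ`

  module _ (T : TBox V) (𝒜 : ABox V) where

    -- Children of individuals remember their parent, deeper points only their last role. The map is
    -- partial, hence a relation: `ℰ` has elements only for individuals of the ABox and roles with
    -- an existential axiom.
    data _↦_ : Point V → Element T 𝒜 → Set where
      named : ∀ {a} .{a∈} → named a ↦ named a a∈
      c₁    : ∀ {a r} .{a∈} .{r∈} → child (named a) r ↦ c₁ a r a∈ r∈
      c₂    : ∀ {d d′ r} .{r∈} → d ↦ d′ → Anonymous T 𝒜 d′ → child d r ↦ c₂ r r∈

    -- Facts that meet at a point of the chase must meet in `ℰ` too, both in a composition and along
    -- a path.
    ↦-functional : ∀ {d d′ d″} → d ↦ d′ → d ↦ d″ → d′ ≡ d″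
    ↦-functional named        named        = refl
    ↦-functional c₁           c₁           = refl
    ↦-functional c₁           (c₂ named ())
    ↦-functional (c₂ named ()) c₁
    ↦-functional (c₂ _ _)     (c₂ _ _)     = refl

    mutual
      toℰᶜ : ∀ {A d m} → Chaseᶜ T 𝒜 A d m → ∃ λ d′ → d ↦ d′ × ℰᶜ T 𝒜 A d′
      toℰᶜ (assertion p)    = named _ (concept-individual p) , named , assertion p
      toℰᶜ (inclusion ax c) with d′ , d↦ , h ← toℰᶜ c = d′ , d↦ , inclusion ax h
      toℰᶜ (exists ax c)    with d′ , _ , d↦ , _ , h ← toℰʳ c = d′ , d↦ , exists ax h

      toℰʳ : ∀ {r d e m} → Chaseʳ T 𝒜 r d e m → ∃₂ λ d′ e′ → d ↦ d′ × e ↦ e′ × ℰʳ T 𝒜 r d′ e′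
      toℰʳ (assertion p) =
        named _ (role-individual₁ p) , named _ (role-individual₂ p) , named , named , assertion p
      toℰʳ (witness ax c) with toℰᶜ c
      ... | _ , named , h = _ , c₁ _ _ _ (_ , ax) , named , c₁ , witness₁ ax h
      ... | _ , d↦@(c₁ {a∈ = a∈} {r∈}) , h =
        _ , c₂ _ (_ , ax) , d↦ , c₂ d↦ (c₁ {a∈ = a∈} {r∈}) , witness₂ ax (c₁ {a∈ = a∈} {r∈}) h
      ... | _ , d↦@(c₂ {r∈ = r∈} _ _) , h =
        _ , c₂ _ (_ , ax) , d↦ , c₂ d↦ (c₂ {r∈ = r∈}) , witness₂ ax (c₂ {r∈ = r∈}) h
      toℰʳ (inclusion ax c)  with d′ , e′ , d↦ , e↦ , h ← toℰʳ c = d′ , e′ , d↦ , e↦ , inclusion ax h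
      toℰʳ (inclusion⁻ ax c) with d′ , e′ , d↦ , e↦ , h ← toℰʳ c = e′ , d′ , e↦ , d↦ , inclusion⁻ ax h
      toℰʳ (composition ax c c′)
        with d′ , e′ , d↦ , e↦ , h ← toℰʳ c | e″ , f′ , e↦′ , f↦ , h′ ← toℰʳ c′
        with refl ← ↦-functional e↦ e↦′ = d′ , f′ , d↦ , f↦ , composition ax h h′

  -- Bounding recursive paths and deriving them in the unfolding

  module Unfolding {N : SimpleRoles V} (T : TBox V) (isDL : IsDL-Lite-HR N T)
                   {𝒞 : Pred (OrderConstraint N) 0ℓ} (covers : Covers 𝒞 T)
                   (ℓ : ℕ) (bounded : ∀ {c} → 𝒞 c → length (OrderConstraint.carrier c) ≤ ℓ)
                   (𝒜 : ABox V) (admissible : Admissible 𝒞 T 𝒜) where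

    T′ : TBox (unfolded V)
    T′ = k-unfolding T ℓ

    𝒜′ : ABox (unfolded V)
    𝒜′ = liftABox 𝒜

    -- Each edge is recorded twice: its derivation from `T` maps to `ℰ`, where admissibility bounds
    -- the length, and its derivation from `T′` rebuilds the path by levels.
    data Path (r : NR) (d : Point V) : Point V → ℕ → Set where
      []   : Path r d d 0
      _∷ʳ_ : ∀ {s e f k} → Path r d e k →
             S T r s × (∃ λ m → Chaseʳ T 𝒜 s e f m) × (∃ λ m → Chaseʳ T′ 𝒜′ (base s) (embed e) (embed f) m) →
             Path r d f (suc k)

    module _ {r : NR} where
      o = proj₁ (covers r)
      open StrictOrder o using (_≺_)

      -- Each `s` may come with its own carrier, but comparisons are stated in the order shared by
      -- all of `S T r`. As `≺` is not assumed decidable, they hold only up to double negation.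
      Constrains : OrderConstraint N → NR → Set
      Constrains c s =
          (∀ {A B} → A ≺ B → OrderConstraint._≺_ c A B)
        × (∀ {d e} → ℰʳ T 𝒜 s d e → ∃₂ λ A B → A ∈ carrier × B ∈ carrier × ℰᶜ T 𝒜 A d × ℰᶜ T 𝒜 B e)
        × (∀ {A B d e} → A ∈ carrier → B ∈ carrier → ℰʳ T 𝒜 s d e → ℰᶜ T 𝒜 A d → ℰᶜ T 𝒜 B e → ¬ ¬ (A ≺ B))
        where open OrderConstraint c using (carrier)

      constraint : ∀ {s} → S T r s → ∃ λ c → 𝒞 c × Constrains c s
      constraint {s} r·s with c , c∈𝒞 , roleName≡s , _ , c⊆o , o⊆c ← proj₂ (covers r) r·s =
        c , c∈𝒞 , o⊆c , typed ∘ at-roleName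
          , λ A∈ B∈ sde Ad Be A⊀B → ordered A∈ B∈ (A⊀B ∘ c⊆o) (at-roleName sde , Ad , Be)
        where
        open Satisfies (admissible c∈𝒞)
        at-roleName : ∀ {d e} → ℰʳ T 𝒜 s d e → ⟦ OrderConstraint.roleName c ⟧ʳ (ℰ T 𝒜) d e
        at-roleName {d} {e} = subst (λ p → ⟦ p ⟧ʳ (ℰ T 𝒜) d e) (sym roleName≡s)

      -- The path is followed backwards. That `A` lies below some `B` puts `A` in the carrier of
      -- every constraint chosen for `S T r`, whose orders all agree; so the name at the source of
      -- the last edge must lie below `A`, and the argument repeats.
      descend : ∀ {d e e′ k A B} → Path r d e k → _↦_ T 𝒜 e e′ → ℰᶜ T 𝒜 A e′ → A ≺ B →
                ¬ ¬ (∃ λ xs → length xs ≡ k × Descending o A xs)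
      descend [] _ _ _ none = none ([] , refl , [-])
      descend (p ∷ʳ (r·s , (_ , fact) , _)) e↦ Ae A≺B none
        with c , _ , o⊆c , typed , ordered ← constraint r·s
        with d′ , _ , d↦ , e↦′ , sde ← toℰʳ T 𝒜 fact
        with refl ← ↦-functional T 𝒜 e↦ e↦′
        with C , _ , C∈ , _ , Cd , _ ← typed sde =
        ordered C∈ (proj₁ (OrderConstraint.over c (o⊆c A≺B))) sde Cd Ae λ C≺A →
          descend p d↦ Cd C≺A λ (xs , len , lnk) → none (C ∷ xs , cong suc len , C≺A ∷ lnk)

      path-length : ∀ {d e k} → Path r d e k → k ≤ ℓ
      path-length [] = z≤n
      -- The bound is decidable, which discharges the double negations.
      path-length {k = suc k} (p ∷ʳ (r·s , (_ , fact) , _)) = decidable-stable (suc k ℕ.≤? ℓ) λ k≰ℓ →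
        let c , c∈𝒞 , o⊆c , typed , ordered = constraint r·s
            _ , _ , d↦ , _ , sde = toℰʳ T 𝒜 fact
            A , B , A∈ , B∈ , Ad , Be = typed sde
        in ordered A∈ B∈ sde Ad Be λ A≺B → descend p d↦ Ad A≺B λ (xs , len , lnk) →
          let B∈o = proj₂ (OrderConstraint.over c (o⊆c A≺B))
          -- `B`, `A` and `xs` are k + 2 names, one for each vertex of a path with k + 1 edges;
          -- `ℕ.n≤1+n` gives away the surplus.
          in k≰ℓ (ℕ.≤-trans (ℕ.n≤1+n _) (ℕ.≤-trans (subst (λ m → suc (suc m) ≤ _) len
               (descending-length (OrderConstraint.order c) B∈o (o⊆c A≺B ∷ Linked.map o⊆c lnk))) (bounded c∈𝒞)))

    unfold-∈ : ∀ {α β} → α ∈ T → β ∈ unfoldAxiom T ℓ α → β ∈ T′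
    unfold-∈ α∈ β∈ = ∈-concatMap⁺ (unfoldAxiom T ℓ) (lose α∈ β∈)

    loop-∈ : ∀ {r s β} → S T r s → β ∈ unfoldLoop T ℓ r s → β ∈ T′
    loop-∈ {r} {s} {β} r·s β∈ = unfold-∈ r·s lemma
      where
      lemma : β ∈ unfoldAxiom T ℓ (r · s ⊑ r)
      lemma with r ≟ʳ r
      ... | yes _  = β∈
      ... | no r≢r = contradiction refl r≢r

    composition-∈ : ∀ {r s t} → (r · s ⊑ t) ∈ T → r ≢ t → (hatRole T r · base s ⊑ base t) ∈ T′
    composition-∈ {r} {s} {t} ax r≢t = unfold-∈ ax lemma
      where
      lemma : (hatRole T r · base s ⊑ base t) ∈ unfoldAxiom T ℓ (r · s ⊑ t)
      lemma with r ≟ʳ t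
      ... | yes r≡t = contradiction r≡t r≢t
      ... | no  _   = here refl

    -- A recursive role is the right-hand side of a CRI, hence not simple, whereas the second role
    -- of a CRI is simple. So `base s` suffices for second factors.
    second-nonrecursive : ∀ {r s t} → (r · s ⊑ t) ∈ T → ¬ Recursive T s
    second-nonrecursive ax (_ , loop) =
      proj₂ (IsDL-Lite-HR.cri isDL loop) (proj₁ (IsDL-Lite-HR.cri isDL ax))

    Chased : UnfoldedRole NR → Point V → Point V → Set
    Chased r d e = ∃ (Chaseʳ T′ 𝒜′ r (embed d) (embed e))

    -- The pairs added by r · s ⊑ r are kept as a path, to be counted later.
    Split : NR → Point V → Point V → Set
    Split r d e = ∃₂ λ e₀ k → Chased (base r) d e₀ × Path r e₀ e k

    split-base : ∀ {r d e} → ¬ Recursive T r → Split r d e → Chased (base r) d e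
    split-base _   (_ , _ , h , [])                 = h
    split-base ¬rec (_ , _ , h , (_ ∷ʳ (r·s , _))) = contradiction (_ , r·s) ¬rec

    -- Each edge climbs one level by the axiom of its own role, and `k ≤ ℓ` keeps these axioms
    -- within the unfolding. The argument `S T r s` serves the empty path, where it puts
    -- `base r ⊑ʳ level r 0` into `T′`.
    level-path : ∀ {r s d e₀ e k} → S T r s → Chased (base r) d e₀ → Path r e₀ e k → k ≤ ℓ → Chased (level r k) d e
    level-path r·s (_ , h) [] _ = _ , inclusion (loop-∈ r·s (here refl)) h
    level-path {k = suc k} r·s h (p ∷ʳ (r·s′ , _ , (_ , g))) k<ℓ
      with _ , h′ ← level-path r·s h p (ℕ.<⇒≤ k<ℓ) =
      _ , composition (loop-∈ r·s′ (there (∈-++⁺ˡ (∈-map⁺ _ (∈-upTo⁺ k<ℓ))))) h′ g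

    -- For a recursive role the length bound lets the levels absorb the path; for any other role the
    -- path is empty.
    split-hat : ∀ {r d e} → Split r d e → Chased (hatRole T r) d e
    split-hat {r} h with recursive? T r
    ... | no ¬rec = split-base ¬rec h
    ... | yes (s , r·s) with _ , _ , b , p ← h
      with _ , g ← level-path r·s b p (path-length p) =
      _ , inclusion (loop-∈ r·s (there (∈-++⁺ʳ _ (∈-map⁺ _ (∈-upTo⁺ (s≤s (path-length p))))))) g

    mutual
      unfoldᶜ : ∀ {A d m} → Chaseᶜ T 𝒜 A d m → ∃ (Chaseᶜ T′ 𝒜′ A (embed d))
      unfoldᶜ (assertion p)    = _ , assertion (∈-map⁺ _ p)
      unfoldᶜ (inclusion ax c) = _ , inclusion (unfold-∈ ax (here refl)) (proj₂ (unfoldᶜ c))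
      unfoldᶜ (exists ax c) with _ , _ , (_ , h) , _ ← unfoldʳ c = _ , exists (unfold-∈ ax (here refl)) h

      unfoldʳ : ∀ {r d e m} → Chaseʳ T 𝒜 r d e m → Split r d e
      unfoldʳ (assertion p)     = _ , _ , (_ , assertion (∈-map⁺ _ p)) , []
      unfoldʳ (witness ax c)    = _ , _ , (_ , witness (unfold-∈ ax (here refl)) (proj₂ (unfoldᶜ c))) , []
      unfoldʳ (inclusion ax c)  = _ , _ , (_ , inclusion (unfold-∈ ax (here refl)) (proj₂ (split-hat (unfoldʳ c)))) , []
      unfoldʳ (inclusion⁻ ax c) = _ , _ , (_ , inclusion⁻ (unfold-∈ ax (here refl)) (proj₂ (split-hat (unfoldʳ c)))) , []
      unfoldʳ (composition {r} {t = t} ax c c′) with split-base (second-nonrecursive ax) (unfoldʳ c′)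
      ... | g with r ≟ʳ t
      ...   | no r≢t = _ , _ , (_ , composition (composition-∈ ax r≢t) (proj₂ (split-hat (unfoldʳ c))) (proj₂ g)) , []
      -- The removed axiom `r · s ⊑ r` lengthens the path instead.
      ...   | yes refl with _ , _ , b , p ← unfoldʳ c = _ , _ , b , p ∷ʳ (ax , (_ , c′) , g)

    chase-unfolds : ∀ {n as} (q : CQ V n) → chase T 𝒜 ⊨ q ⟨ as ⟩ → chase T′ 𝒜′ ⊨ hatQuery T q ⟨ as ⟩
    chase-unfolds {as = as} q (π , hd , sat) = embed ∘ π , hd′ , sat′
      where
      hd′ : Vec.map (embed ∘ π) (CQ.head q) ≡ Vec.map named as
      hd′ = trans (map-∘ embed π (CQ.head q)) (trans (cong (Vec.map embed) hd) (sym (map-∘ embed named as)))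
      sat′ : ∀ {α} → α ∈ CQ.body (hatQuery T q) → SatisfiesAtom (chase T′ 𝒜′) (embed ∘ π) α
      sat′ α∈ with ∈-map⁻ _ α∈
      ... | concept A x , β∈ , refl = unfoldᶜ (proj₂ (sat β∈))
      ... | role r x y  , β∈ , refl = split-hat (unfoldʳ (proj₂ (sat β∈)))
      ... | equal (var x) (var y) , β∈ , refl = cong embed (sat β∈)
      ... | equal (var x) (ind b) , β∈ , refl = cong embed (sat β∈)
      ... | equal (ind a) (var y) , β∈ , refl = cong embed (sat β∈)
      ... | equal (ind a) (ind b) , β∈ , refl = cong embed (sat β∈)

  -- Soundness of the unfolding

  module _ (I : Interpretation V) where
    open Interpretation I

    unfoldedInterpretation : Interpretation (unfolded V)
    unfoldedInterpretation = record
      { structure = record { Δ = Δ ; concᴵ = concᴵ ; roleᴵ = roleᴵ ∘ underlying }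
      ; indᴵ = indᴵ ; injective = injective }

    module _ (T : TBox V) where

      hat⁻ : ∀ {r d e} → roleᴵ (underlying (hatRole T r)) d e → roleᴵ r d e
      hat⁻ {r} = subst (λ s → roleᴵ s _ _) (underlying-hatRole T r)

      -- Once all copies of `r` are read as `r`, the inclusions become identities and every
      -- composition becomes `r · s ⊑ r`.
      loop-sound : ∀ {k r s β} → I ⊨ᵃˣ (r · s ⊑ r) → β ∈ unfoldLoop T k r s → unfoldedInterpretation ⊨ᵃˣ β
      loop-sound h (here refl) = id
      loop-sound {k} {r} {s} h (there β∈)
        with ∈-++⁻ (map (λ j → level r j · base s ⊑ level r (suc j)) (upTo k)) β∈
      ... | inj₁ β∈ with _ , _ , refl ← ∈-map⁻ _ β∈ = h
      ... | inj₂ β∈ with _ , _ , refl ← ∈-map⁻ (λ j → level r j ⊑ʳ hat r) β∈ = id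

      unfold-sound : ∀ k α {β} → I ⊨ᵃˣ α → β ∈ unfoldAxiom T k α → unfoldedInterpretation ⊨ᵃˣ β
      unfold-sound k (A ⊑ᶜ B)    h (here refl) = h
      unfold-sound k (A ⊑∃ p)    h (here refl) = h
      unfold-sound k (∃ p ⊑ A)   h (here refl) = h
      unfold-sound k (p ⊑ʳ s)    h (here refl) = h ∘ hat⁻
      unfold-sound k (p ⊑ʳ s ⁻)  h (here refl) = h ∘ hat⁻
      unfold-sound k (disjᶜ A B) h (here refl) = h
      unfold-sound k (disjʳ p s) h (here refl) = h
      unfold-sound k (r · s ⊑ t) h β∈ with r ≟ʳ t
      unfold-sound k (r · s ⊑ t) h β∈          | yes refl = loop-sound h β∈
      unfold-sound k (r · s ⊑ t) h (here refl) | no _     = h ∘ hat⁻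

      unfolding-sound : ∀ {k β} → (∀ {α} → α ∈ T → I ⊨ᵃˣ α) → β ∈ k-unfolding T k → unfoldedInterpretation ⊨ᵃˣ β
      unfolding-sound {k} axioms β∈ with α , α∈ , β∈α ← find (∈-concatMap⁻ (unfoldAxiom T k) {xs = T} β∈) =
        unfold-sound k α (axioms α∈) β∈α

      lift-sound : ∀ {𝒜 β} → (∀ {α} → α ∈ 𝒜 → I ⊨ᵃˢ α) → β ∈ liftABox 𝒜 → unfoldedInterpretation ⊨ᵃˢ β
      lift-sound assertions β∈ with ∈-map⁻ _ β∈
      ... | conceptA A a , α∈ , refl = assertions α∈
      ... | roleA p a b  , α∈ , refl = assertions α∈

      query-sound : ∀ {n as} (q : CQ V n) → unfoldedInterpretation ⊨ hatQuery T q ⟨ as ⟩ → I ⊨ q ⟨ as ⟩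
      query-sound q (π , hd , sat) = π , hd , sat′
        where
        sat′ : ∀ {α} → α ∈ CQ.body q → SatisfiesAtom I π α
        sat′ {concept A x} α∈ = sat (∈-map⁺ _ α∈)
        sat′ {role r x y}  α∈ = hat⁻ (sat (∈-map⁺ _ α∈))
        sat′ {equal (var x) (var y)} α∈ = sat (∈-map⁺ _ α∈)
        sat′ {equal (var x) (ind b)} α∈ = sat (∈-map⁺ _ α∈)
        sat′ {equal (ind a) (var y)} α∈ = sat (∈-map⁺ _ α∈)
        sat′ {equal (ind a) (ind b)} α∈ = sat (∈-map⁺ _ α∈)

  rewriting-sound : ∀ {T : TBox V} {𝒜 k n as Z I} {q : CQ V n} {q′} → IsModel I T 𝒜 →
                    k-rewriting Z k T q q′ →
                    (∀ J → IsModel J [] (liftABox 𝒜) → J ⊨ q′ ⟨ as ⟩) → I ⊨ q ⟨ as ⟩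
  rewriting-sound {T} {Z = Z} {I} {q} model ss answers =
    query-sound I T q
      (rew-sound (unfoldedInterpretation I) (unfolding-sound I T (IsModel.axioms model)) Z ss
        (answers (unfoldedInterpretation I) record
          { axioms = λ () ; assertions = lift-sound I T (IsModel.assertions model) }))

  -- The chase as a universal model

  module Certain {N : SimpleRoles V} (T : TBox V) (isDL : IsDL-Lite-HR N T)
                 {𝒞 : Pred (OrderConstraint N) 0ℓ} (covers : Covers 𝒞 T)
                 (ℓ : ℕ) (bounded : ∀ {c} → 𝒞 c → length (OrderConstraint.carrier c) ≤ ℓ)
                 (𝒜 : ABox V) (admissible : Admissible 𝒞 T 𝒜)
                 (Z : FreshVariable (unfolded V)) where
    open Unfolding T isDL covers ℓ bounded 𝒜 admissible

    chase-rewriting : ∀ {n as} (q : CQ V n) → chase T 𝒜 ⊨ q ⟨ as ⟩ →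
                      ∃ λ q′ → k-rewriting Z ℓ T q q′ × (∀ J → IsModel J [] 𝒜′ → J ⊨ q′ ⟨ as ⟩)
    chase-rewriting {as = as} q h =
      Completeness.rew-complete T′ 𝒜′ Z as (hatQuery T q) (chase-unfolds q h)

    -- No homomorphism into `I` is built: a match in the chase yields a rewriting answered by the
    -- ABox alone, and rewriting is sound in every model.
    chase-universal : ∀ {n as I} (q : CQ V n) → IsModel I T 𝒜 → chase T 𝒜 ⊨ q ⟨ as ⟩ → I ⊨ q ⟨ as ⟩
    chase-universal q model h with _ , ss , answers ← chase-rewriting q h = rewriting-sound model ss answers

    -- Both come from freshness, the second from a query that mentions the first. They name the two
    -- ends of a violation of `disjʳ`.
    two-variables : ∃₂ λ x y → x ≢ y
    two-variables = x , FreshVariable.z Z q , λ x≡z → FreshVariable.fresh Z q (here (sym x≡z))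
      where
      x = FreshVariable.z Z (query [] [])
      q = query [] (equal (var x) (var x) ∷ [])

    -- The chase satisfies disjᶜ and disjʳ because a violation is a match of a
    -- query, and hence reappears in the given model.
    chase-model : Consistent T 𝒜 → IsModel (chase T 𝒜) T 𝒜
    chase-model (I , model) = record
      { axioms     = λ {α} → axioms α
      ; assertions = λ { {conceptA A a} p → _ , assertion p ; {roleA p a b} p∈ → _ , assertion p∈ } }
      where
      x = proj₁ two-variables
      y = proj₁ (proj₂ two-variables)
      open Assignment V

      at : ∀ {r d e} → ∃ (Chaseʳ T 𝒜 r d e) → ∃ (Chaseʳ T 𝒜 r ((const d [ y := e ]) x) ((const d [ y := e ]) y))
      at {r} {d} = subst₂ (λ d e → ∃ (Chaseʳ T 𝒜 r d e))
        (update-off {π = const d} (proj₂ (proj₂ two-variables))) (sym (update-at {π = const d} y))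

      axioms : ∀ α → α ∈ T → chase T 𝒜 ⊨ᵃˣ α
      axioms (A ⊑ᶜ B)    ax (_ , c)             = _ , inclusion ax c
      axioms (A ⊑∃ p)    ax (_ , c)             = _ , _ , witness ax c
      axioms (∃ p ⊑ A)   ax (_ , _ , c)         = _ , exists ax c
      axioms (p ⊑ʳ s)    ax (_ , c)             = _ , inclusion ax c
      axioms (p ⊑ʳ s ⁻)  ax (_ , c)             = _ , inclusion⁻ ax c
      axioms (r · s ⊑ t) ax (_ , c) (_ , c′)    = _ , composition ax c c′
      axioms (disjᶜ A B) ax {d} (Ad , Bd)
        with _ , _ , sat ← chase-universal {as = []} (query [] (concept A x ∷ concept B x ∷ [])) model
               (const d , refl , λ { (here refl) → Ad ; (there (here refl)) → Bd })
        = IsModel.axioms model ax (sat (here refl) , sat (there (here refl)))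
      axioms (disjʳ p s) ax {d} {e} (pde , sde)
        with _ , _ , sat ← chase-universal {as = []} (query [] (role p x y ∷ role s x y ∷ [])) model
               (const d [ y := e ] , refl , λ { (here refl) → at pde ; (there (here refl)) → at sde })
        = IsModel.axioms model ax (sat (here refl) , sat (there (here refl)))

theorem4 :
  (V : Vocabulary) → CountablyInfinite V →
  (N : SimpleRoles V) (T : TBox V) → IsDL-Lite-HR N T → RecursionSafe N T →
  (𝒞 : Pred (OrderConstraint N) 0ℓ) → Covers 𝒞 T →
  (ℓ : ℕ) → IsMaxSize 𝒞 ℓ →
  (Z : FreshVariable (unfolded V)) →
  {n : ℕ} (q : CQ V n) →
  (𝒜 : ABox V) → Consistent T 𝒜 → Admissible 𝒞 T 𝒜 →
  cert q T 𝒜 ≐ certᵁ (k-rewriting Z ℓ T q) [] (liftABox 𝒜)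
theorem4 V _ N T isDL _ 𝒞 covers ℓ (bounded , _) Z q 𝒜 consistent admissible = complete , sound
  where
  open Certain T isDL covers ℓ bounded 𝒜 admissible Z
  complete : ∀ {as} → cert q T 𝒜 as → certᵁ (k-rewriting Z ℓ T q) [] (liftABox 𝒜) as
  -- Consistency makes the chase a model, so a certain answer holds there.
  complete (as∈ , certain)
    with q′ , ss , answers ← chase-rewriting q (certain (chase T 𝒜) (chase-model consistent)) =
    q′ , ss , VecAll.map (subst (_ ∈_) (sym (individuals-lift 𝒜))) as∈ , answers
  sound : ∀ {as} → certᵁ (k-rewriting Z ℓ T q) [] (liftABox 𝒜) as → cert q T 𝒜 as
  sound (q′ , ss , as∈ , answers) =
    VecAll.map (subst (_ ∈_) (individuals-lift 𝒜)) as∈ , λ I model → rewriting-sound model ss answers
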